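{- For every odd prime $p$, every skew morphism of the cyclic group $\mathrm{C}_{16p}$ is coset-preserving.
   Context: For a finite group $B$, a skew morphism of $B$ is a permutation $\varphi$ of $B$ fixing the identity such that for every $a\in B$ there is a positive integer $i_a$ with $\varphi(ab)=\varphi(a)\varphi^{i_a}(b)$ for all $b\in B$. Its order $\mathrm{ord}(\varphi)$ is the order of $\langle\varphi\rangle$. The power function $\pi$ maps $a$ to the unique such $i_a\in\{1,\dots,\mathrm{ord}(\varphi)\}$ (with $\pi\equiv1$ for the identity). $\varphi$ is coset-preserving if $\pi(\varphi(a))=\pi(a)$ for all $a\in B$. -}

module Defs where

open import Data.Nat using (ℕ; zero; suc; _+_; _*_; _≤_; _<_; _%_)
open import Data.Nat.DivMod using (m%n<n)
open import Data.Fin using (Fin; toℕ; fromℕ<) renaming (zero to fzero)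
open import Relation.Nullary using (¬_)
open import Data.Fin.Permutation using (Permutation′; _⟨$⟩ʳ_)
open import Data.Product using (Σ; _×_)
open import Relation.Binary.PropositionalEquality using (_≡_; _≢_)
open import Function using (id; _∘_)

_⊕_ : ∀ {n} → Fin n → Fin n → Fin n
_⊕_ {suc n} a b = fromℕ< (m%n<n (toℕ a + toℕ b) (suc n))

e : ∀ {n} → Fin (suc n)
e = fzero

iter : ∀ {A : Set} → (A → A) → ℕ → A → A
iter f zero    = id
iter f (suc k) = f ∘ iter f k

_^[_]_ : ∀ {n} → Permutation′ n → ℕ → Fin n → Fin n
φ ^[ i ] x = iter (φ ⟨$⟩ʳ_) i x

IsSkewMorphism : ∀ {n} → Permutation′ (suc n) → Set
IsSkewMorphism {n} φ =
  (φ ⟨$⟩ʳ e ≡ e) ×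
  ((a : Fin (suc n)) → Σ ℕ λ i → (1 ≤ i) ×
     ((b : Fin (suc n)) → φ ⟨$⟩ʳ (a ⊕ b) ≡ (φ ⟨$⟩ʳ a) ⊕ (φ ^[ i ] b)))

IsIdentityPower : ∀ {n} → Permutation′ n → ℕ → Set
IsIdentityPower {n} φ k = (x : Fin n) → φ ^[ k ] x ≡ x

IsOrder : ∀ {n} → Permutation′ n → ℕ → Set
IsOrder φ m =
  (1 ≤ m) × IsIdentityPower φ m ×
  ((k : ℕ) → 1 ≤ k → k < m → ¬ IsIdentityPower φ k)

-- π(a) = i : the unique i ∈ {1,…,ord φ} with φ(a b) = φ(a) φ^i(b) for all b
-- (here m denotes ord φ).
IsPowerValue : ∀ {n} → Permutation′ (suc n) → (m : ℕ) → Fin (suc n) → ℕ → Set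
IsPowerValue {n} φ m a i =
  (1 ≤ i) × (i ≤ m) ×
  ((b : Fin (suc n)) → φ ⟨$⟩ʳ (a ⊕ b) ≡ (φ ⟨$⟩ʳ a) ⊕ (φ ^[ i ] b))

IsCosetPreserving : ∀ {n} → Permutation′ (suc n) → (m : ℕ) → Set
IsCosetPreserving {n} φ m =
  (a : Fin (suc n)) (i j : ℕ) →
  IsPowerValue φ m (φ ⟨$⟩ʳ a) i → IsPowerValue φ m a j → i ≡ j

{-# OPTIONS --safe #-}
module Submission where

-- A permutation of ℤ/n is lifted to ℤ, so that its quotients are the same map read modulo
-- divisors of n. The order m of a skew morphism φ of ℤ/n is the length of the orbit of 1,
-- hence m < n; so two values of the power function π agree mod m and the kernel is
-- nontrivial. By induction along quotients, the kernel of φ on ℤ/2ᵏp contains the subgroup P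
-- of order p, and for n = 16p there is a quotient of φ on ℤ/16. Repeated halving confines
-- the skew morphisms of ℤ/16 to a small search tree; all are coset-preserving, with φ⁸ = 1.
--
-- It remains to compare π(φ x) with π(x). Let r be the multiplier of φ on P, and choose T
-- with φᵀ = 1 on ℤ/16, rᵀ = 1 and T ≡ 1 mod p. Then F x = φᵀ x − x lies in P. If F = 0, then
-- φ^{π(φ x)} = φ^{π(x)} can be checked on ℤ/16 and on P. Otherwise F(x + y) = F x + s(x) F y
-- for a nontrivial character s : ℤ/16 → 𝔽ₚ* invariant under φ; this forces r = 1, and
-- weighting the skew identity by s⁻¹ and summing over ℤ/16 gives π ≡ s mod p, so that π is
-- φ-invariant mod p as well.

open import Defs using (iter)

-- The obstacle is that the actions on ℤ/16 and on P do not determine a power of φ: a power trivial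
-- on both can still move points inside the cosets of P. For such an exponent D one has
-- `φ^D x − x = D F x` mod p, so the missing information is D mod p, and it matters only where `F`
-- is nonzero. The exponent T isolates this p-part; it exists because 8 and some exponent below p
-- that trivialises r are both prime to p.
--
-- The equation for `F` is a cocycle identity. Its character s is nontrivial because `s z = 1` would
-- give `16 F z = F (16 z) = 0` with 16 invertible mod p. Once `r = 1`, the map `x ↦ φ x − x` taken
-- mod p is a function on ℤ/16, and only then can the skew identity be summed there. The sum has the
-- form `s x · A = π x · A` for a constant A, so the decisive point is that A does not vanish. Were
-- it zero, the corresponding weighted sum of `F` would vanish too, and translating that sum by z
-- would again force `16 F z = 0`.

module IntegerModel where

  open import Data.Fin as Fin using (Fin; toℕ; fromℕ<)
  import Data.Fin.Properties as Finₚ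
  open import Data.Fin.Permutation using (Permutation′; permutation; _⟨$⟩ʳ_)
  open import Data.Integer using (ℤ; +_; _+_; _*_; _-_; -_; _^_; ∣_∣; 0ℤ; 1ℤ)
  open import Data.Integer.Divisibility.Signed as ℤ∣ using ()
  open import Data.Integer.DivMod using (_/ℕ_; n%ℕd<d; a≡a%ℕn+[a/ℕn]*n)
  open import Data.Integer.Properties as ℤₚ using (pos-*; pos-+; abs-*)
  open import Data.Integer.Tactic.RingSolver using (solve-∀)
  open import Data.List.Base using (List; []; _∷_; _++_; applyUpTo; upTo; map; concatMap; filter)
  open import Data.List.Membership.Propositional using (_∈_; lose)
  open import Data.List.Membership.Propositional.Properties using (∈-concatMap⁺; ∈-filter⁺; ∈-map⁺)
  import Data.List.Properties as Listₚ
  open import Data.List.Relation.Unary.All as All using (All; []; _∷_; all?)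
  import Data.List.Relation.Unary.All.Properties as Allₚ
  open import Data.List.Relation.Unary.Any as Any using (Any; here; there; any?)
  import Data.List.Relation.Unary.Any.Properties as Anyₚ
  open import Data.Nat as ℕ using (ℕ; zero; suc; z≤n; s≤s)
  import Data.Nat.DivMod as ℕ/
  import Data.Nat.Divisibility as ℕ∣
  open import Data.Nat.GCD using (gcd; gcd-GCD; gcd[m,n]∣m; gcd[m,n]∣n; module Bézout)
  open import Data.Nat.ListAction using (product)
  open import Data.Nat.Primality
    using (Prime; euclidsLemma; prime⇒irreducible; prime⇒nonZero; prime⇒nonTrivial; ¬prime[1]; prime[2])
  open import Data.Nat.Primality.Factorisation using (factorise)
  import Data.Nat.Properties as ℕₚ
  open import Data.Product using (_×_; _,_; ∃; ∃₂; proj₁; proj₂)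
  open import Data.Sum using (_⊎_; inj₁; inj₂)
  open import Function using (_∘_)
  open import Relation.Binary.Bundles using (Setoid)
  open import Relation.Binary.PropositionalEquality hiding ([_])
  import Relation.Binary.Reasoning.Setoid as SetoidReasoning
  open import Relation.Nullary
  open import Relation.Nullary.Decidable using (from-yes)
  import Algebra.Properties.Semiring.Sum ℤₚ.+-*-semiring as Sum

  -- Congruences of integers

  infix 4 _≡_[_]

  record _≡_[_] (x y : ℤ) (n : ℕ) : Set where
    constructor by
    field
      quotient : ℤ
      equality : x ≡ y + quotient * + n

  private
    variable
      n : ℕ
      x y z w : ℤ

  mod-reflexive : x ≡ y → x ≡ y [ n ]
  mod-reflexive {x} {n = n} refl = by 0ℤ (lemma x (+ n))
    where
    lemma : ∀ x n → x ≡ x + 0ℤ * n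
    lemma = solve-∀

  mod-refl : x ≡ x [ n ]
  mod-refl = mod-reflexive refl

  mod-sym : x ≡ y [ n ] → y ≡ x [ n ]
  mod-sym {y = y} {n} (by k refl) = by (- k) (lemma y k (+ n))
    where
    lemma : ∀ y k n → y ≡ y + k * n + (- k) * n
    lemma = solve-∀

  mod-trans : x ≡ y [ n ] → y ≡ z [ n ] → x ≡ z [ n ]
  mod-trans {n = n} {z} (by k refl) (by l refl) = by (l + k) (lemma z k l (+ n))
    where
    lemma : ∀ z k l n → z + l * n + k * n ≡ z + (l + k) * n
    lemma = solve-∀

  mod-+ : x ≡ y [ n ] → z ≡ w [ n ] → x + z ≡ y + w [ n ]
  mod-+ {y = y} {n} {w = w} (by k refl) (by l refl) = by (k + l) (lemma y w k l (+ n))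
    where
    lemma : ∀ y w k l n → y + k * n + (w + l * n) ≡ y + w + (k + l) * n
    lemma = solve-∀

  mod-* : x ≡ y [ n ] → z ≡ w [ n ] → x * z ≡ y * w [ n ]
  mod-* {y = y} {n} {w = w} (by k refl) (by l refl) =
    by (k * w + y * l + k * l * + n) (lemma y w k l (+ n))
    where
    lemma : ∀ y w k l n →
      (y + k * n) * (w + l * n) ≡ y * w + (k * w + y * l + k * l * n) * n
    lemma = solve-∀

  mod-neg : x ≡ y [ n ] → - x ≡ - y [ n ]
  mod-neg {y = y} {n} (by k refl) = by (- k) (lemma y k (+ n))
    where
    lemma : ∀ y k n → - (y + k * n) ≡ - y + (- k) * n
    lemma = solve-∀

  mod-- : x ≡ y [ n ] → z ≡ w [ n ] → x - z ≡ y - w [ n ]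
  mod-- p q = mod-+ p (mod-neg q)

  mod-+ˡ : ∀ c → x ≡ y [ n ] → c + x ≡ c + y [ n ]
  mod-+ˡ c e = mod-+ (mod-refl {x = c}) e

  mod-+ʳ : ∀ c → x ≡ y [ n ] → x + c ≡ y + c [ n ]
  mod-+ʳ c e = mod-+ e (mod-refl {x = c})

  mod-*ˡ : ∀ c → x ≡ y [ n ] → c * x ≡ c * y [ n ]
  mod-*ˡ c e = mod-* (mod-refl {x = c}) e

  mod-*ʳ : ∀ c → x ≡ y [ n ] → x * c ≡ y * c [ n ]
  mod-*ʳ c e = mod-* e (mod-refl {x = c})

  mod-cancelˡ : ∀ c → c + x ≡ c + y [ n ] → x ≡ y [ n ]
  mod-cancelˡ {x} {y} {n} c (by k eq) = by k (begin
    x                       ≡⟨ lemma₁ x c ⟩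
    - c + (c + x)           ≡⟨ cong (λ e → - c + e) eq ⟩
    - c + (c + y + k * + n) ≡⟨ lemma₂ y c k (+ n) ⟩
    y + k * + n             ∎)
    where
    open ≡-Reasoning
    lemma₁ : ∀ x c → x ≡ - c + (c + x)
    lemma₁ = solve-∀
    lemma₂ : ∀ y c k n → - c + (c + y + k * n) ≡ y + k * n
    lemma₂ = solve-∀

  mod-cancelʳ : ∀ c → x + c ≡ y + c [ n ] → x ≡ y [ n ]
  mod-cancelʳ {x} {y} {n} c eq =
    mod-cancelˡ c (subst₂ (_≡_[ n ]) (ℤₚ.+-comm x c) (ℤₚ.+-comm y c) eq)

  mod-coarsen : ∀ {d} q → x ≡ y [ q ℕ.* d ] → x ≡ y [ d ]
  mod-coarsen {y = y} {d} q (by k refl) =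
    by (k * + q) (cong (λ e → y + e) (trans (cong (k *_) (pos-* q d)) (sym (ℤₚ.*-assoc k (+ q) (+ d)))))

  mod-scale : ∀ {d} q → x ≡ y [ d ] → + q * x ≡ + q * y [ q ℕ.* d ]
  mod-scale {y = y} {d} q (by k refl) = by k (begin
    + q * (y + k * + d)             ≡⟨ lemma (+ q) y k (+ d) ⟩
    + q * y + k * (+ q * + d)       ≡⟨ cong (λ e → + q * y + k * e) (pos-* q d) ⟨
    + q * y + k * + (q ℕ.* d)       ∎)
    where
    open ≡-Reasoning
    lemma : ∀ q y k d → q * (y + k * d) ≡ q * y + k * (q * d)
    lemma = solve-∀

  mod-unscale : ∀ {d} q .{{_ : ℕ.NonZero q}} → + q * x ≡ + q * y [ q ℕ.* d ] → x ≡ y [ d ]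
  mod-unscale {x} {y} {d} (suc q) (by k eq) = by k (ℤₚ.*-cancelˡ-≡ (+ suc q) x (y + k * + d) (begin
    + suc q * x                                 ≡⟨ eq ⟩
    + suc q * y + k * + (suc q ℕ.* d)           ≡⟨ cong (λ e → + suc q * y + k * e) (pos-* (suc q) d) ⟩
    + suc q * y + k * (+ suc q * + d)           ≡⟨ lemma (+ suc q) y k (+ d) ⟩
    + suc q * (y + k * + d)                     ∎))
    where
    open ≡-Reasoning
    lemma : ∀ q y k d → q * y + k * (q * d) ≡ q * (y + k * d)
    lemma = solve-∀

  mod-setoid : ℕ → Setoid _ _
  mod-setoid n = record
    { Carrier = ℤ
    ; _≈_ = _≡_[ n ]
    ; isEquivalence = record { refl = mod-refl ; sym = mod-sym ; trans = mod-trans }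
    }

  module Mod n = SetoidReasoning (mod-setoid n)

  m⇒∣ : x ≡ y [ n ] → n ℕ∣.∣ ∣ x - y ∣
  m⇒∣ {y = y} {n} (by k refl) = ℕ∣.divides ∣ k ∣ (trans (cong ∣_∣ (lemma y (k * + n))) (abs-* k (+ n)))
    where
    lemma : ∀ y l → y + l - y ≡ l
    lemma = solve-∀


  ∣⇒m : n ℕ∣.∣ ∣ x - y ∣ → x ≡ y [ n ]
  ∣⇒m {n} {x} {y} d with ℤ∣.∣ᵤ⇒∣ {+ n} {x - y} d
  ... | ℤ∣.divides q eq = by q (trans (lemma x y) (cong (λ e → y + e) eq))
    where
    lemma : ∀ x y → x ≡ y + (x - y)
    lemma = solve-∀

  mod-dec : ∀ n x y → Dec (x ≡ y [ n ])
  mod-dec n x y with n ℕ∣.∣? ∣ x - y ∣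
  ... | yes d = yes (∣⇒m d)
  ... | no ¬d = no λ e → ¬d (m⇒∣ e)

  module _ {p : ℕ} (prime : Prime p) where

    zero-product : x * y ≡ 0ℤ [ p ] → x ≡ 0ℤ [ p ] ⊎ y ≡ 0ℤ [ p ]
    zero-product {x} {y} e with euclidsLemma ∣ x ∣ ∣ y ∣ prime
         (subst (p ℕ∣.∣_) (trans (cong ∣_∣ (ℤₚ.+-identityʳ (x * y))) (abs-* x y)) (m⇒∣ e))
    ... | inj₁ d = inj₁ (∣⇒m (subst (p ℕ∣.∣_) (cong ∣_∣ (sym (ℤₚ.+-identityʳ x))) d))
    ... | inj₂ d = inj₂ (∣⇒m (subst (p ℕ∣.∣_) (cong ∣_∣ (sym (ℤₚ.+-identityʳ y))) d))

    zero-factorˡ : ¬ y ≡ 0ℤ [ p ] → x * y ≡ 0ℤ [ p ] → x ≡ 0ℤ [ p ]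
    zero-factorˡ {y} {x} y≢0 e with zero-product {x} {y} e
    ... | inj₁ x≡0 = x≡0
    ... | inj₂ y≡0 = contradiction y≡0 y≢0

    mod-*-cancelˡ : ∀ c → ¬ c ≡ 0ℤ [ p ] → c * x ≡ c * y [ p ] → x ≡ y [ p ]
    mod-*-cancelˡ {x} {y} c c≢0 e with zero-product (begin
        c * (x - y)   ≡⟨ lemma c x y ⟩
        c * x - c * y ≈⟨ mod-- e mod-refl ⟩
        c * y - c * y ≡⟨ lemma′ (c * y) ⟩
        0ℤ            ∎)
      where
      open Mod p
      lemma : ∀ c x y → c * (x - y) ≡ c * x - c * y
      lemma = solve-∀
      lemma′ : ∀ x → x - x ≡ 0ℤ
      lemma′ = solve-∀
    ... | inj₁ c≡0 = contradiction c≡0 c≢0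
    ... | inj₂ d = mod-trans (mod-reflexive (lemma x y)) (mod-trans (mod-+ d mod-refl) (mod-reflexive (ℤₚ.+-identityˡ y)))
      where
      lemma : ∀ x y → x ≡ x - y + y
      lemma = solve-∀

  -- Powers and skew morphisms

  iter-+ : ∀ {A : Set} (g : A → A) i j x → iter g (i ℕ.+ j) x ≡ iter g i (iter g j x)
  iter-+ g zero    j x = refl
  iter-+ g (suc i) j x = cong g (iter-+ g i j x)

  iter-swap : ∀ {A : Set} (g : A → A) i j x → iter g i (iter g j x) ≡ iter g j (iter g i x)
  iter-swap g i j x = trans (sym (iter-+ g i j x))
    (trans (cong (λ k → iter g k x) (ℕₚ.+-comm i j)) (iter-+ g j i x))

  iter-* : ∀ {A : Set} (g : A → A) i j x → iter g (i ℕ.* j) x ≡ iter (iter g j) i x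
  iter-* g zero    j x = refl
  iter-* g (suc i) j x = trans (iter-+ g j (i ℕ.* j) x) (cong (iter g j) (iter-* g i j x))

  opaque
    residue : ∀ n .{{_ : ℕ.NonZero n}} → ℤ → Fin n
    residue n x = fromℕ< (n%ℕd<d x n)

    residue-≡ : ∀ n .{{_ : ℕ.NonZero n}} x → x ≡ + toℕ (residue n x) [ n ]
    residue-≡ n x = by (x /ℕ n) (trans (a≡a%ℕn+[a/ℕn]*n x n)
      (cong (λ r → + r + (x /ℕ n) * + n) (sym (Finₚ.toℕ-fromℕ< (n%ℕd<d x n)))))

  ℕ-≡⇒∣ : ∀ a d → + (a ℕ.+ d) ≡ + a [ n ] → n ℕ∣.∣ d
  ℕ-≡⇒∣ {n} a d e = subst (n ℕ∣.∣_) (cong ∣_∣ (trans (cong (λ t → t - + a) (pos-+ a d)) (lemma (+ a) (+ d)))) (m⇒∣ e)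
    where
    lemma : ∀ a d → a + d - a ≡ d
    lemma = solve-∀

  module _ (P : ℕ → Set) (P? : ∀ k → Dec (P k)) where

    least-below : ∀ k → (∃ λ j → P j × (∀ i → i ℕ.< j → ¬ P i)) ⊎ (∀ i → i ℕ.< k → ¬ P i)
    least-below zero = inj₂ λ _ ()
    least-below (suc k) with least-below k | P? k
    ... | inj₁ found | _      = inj₁ found
    ... | inj₂ none  | yes pk = inj₁ (k , pk , none)
    ... | inj₂ none  | no ¬pk = inj₂ none′
      where
      none′ : ∀ i → i ℕ.< suc k → ¬ P i
      none′ i (s≤s i≤k) with ℕₚ.m≤n⇒m<n∨m≡n i≤k
      ... | inj₁ i<k  = none i i<k
      ... | inj₂ refl = ¬pk

    least : ∀ k → P k → ∃ λ j → P j × (∀ i → i ℕ.< j → ¬ P i)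
    least k pk with least-below (suc k)
    ... | inj₁ found = found
    ... | inj₂ none  = contradiction pk (none k ℕₚ.≤-refl)

  -- The positive generator of a subgroup of ℤ, of which `P` is the part in ℕ. Minimality is stated
  -- by divisibility, the form in which orders and orbit lengths are used.
  record Generator (P : ℕ → Set) : Set where
    field
      m        : ℕ
      {{m≢0}}  : ℕ.NonZero m
      member   : P m
      minimal  : ∀ j → P j → m ℕ∣.∣ j

  opaque
    -- Division with remainder by the least positive member leaves a remainder that is again a
    -- member, hence zero.
    generator : (P : ℕ → Set) → (∀ k → Dec (P k)) → P 0 →
      (∀ i j → P i → P j → P (i ℕ.+ j)) → (∀ i j → P i → P (i ℕ.+ j) → P j) →
      ∀ k → P (suc k) → Generator P
    generator P P? P0 add sub k pk with least (P ∘ suc) (P? ∘ suc) k pk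
    ... | m′ , pm , below = record { m = m ; member = pm ; minimal = minimal }
      where
      m : ℕ
      m = suc m′
      multiples : ∀ q → P (q ℕ.* m)
      multiples zero    = P0
      multiples (suc q) = add m (q ℕ.* m) pm (multiples q)
      remainder : ∀ r → r ℕ.< m → P r → r ≡ 0
      remainder zero    _         _  = refl
      remainder (suc r) (s≤s r<m) pr = contradiction pr (below r r<m)
      minimal : ∀ j → P j → m ℕ∣.∣ j
      minimal j pj = ℕ∣.m%n≡0⇒n∣m j m (remainder (j ℕ.% m) (ℕ/.m%n<n j m)
        (sub ((j ℕ./ m) ℕ.* m) (j ℕ.% m) (multiples (j ℕ./ m))
          (subst P (trans (ℕ/.m≡m%n+[m/n]*n j m) (ℕₚ.+-comm (j ℕ.% m) _)) pj)))

  prime-divisor : ∀ h → 2 ℕ.≤ h → ∃₂ λ q e → Prime q × h ≡ q ℕ.* e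
  prime-divisor (suc (suc h)) (s≤s (s≤s z≤n)) with factorise (suc (suc h))
  ... | record { factors = [] ; isFactorisation = () }
  ... | record { factors = q ∷ qs ; isFactorisation = eq ; factorsPrime = pq ∷ _ } =
    q , product qs , pq , eq

  -- A skew morphism of ℤ/n is represented by a map of ℤ that respects congruence mod n,
  -- so that its quotient on ℤ/d, for d ∣ n, is the same map f with the same exponents π.
  record Skew (f : ℤ → ℤ) (π : ℤ → ℕ) (M′ : ℕ) (n : ℕ) : Set where
    field
      cong-mod : x ≡ y [ n ] → f x ≡ f y [ n ]
      zero-mod : f 0ℤ ≡ 0ℤ [ n ]
      skew     : ∀ x y → f (x + y) ≡ f x + iter f (π x) y [ n ]
      period   : ∀ x → iter f (suc M′) x ≡ x [ n ]

  -- The sum of π over the first k points of the orbit of x. It is the exponent of `f^k` at x, as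
  -- the power function is for `f` (see `iter-skew`).
  σ : (ℤ → ℤ) → (ℤ → ℕ) → ℤ → ℕ → ℕ
  σ f π x zero    = 0
  σ f π x (suc k) = π (iter f k x) ℕ.+ σ f π x k

  -- The kernel of the power function, `π c ≡ 1` modulo the order, phrased through `f` alone so that
  -- no order has to be fixed.
  Ker : (ℤ → ℤ) → ℕ → ℤ → Set
  Ker f n c = ∀ y → f (c + y) ≡ f c + f y [ n ]

  Fixes : (ℤ → ℤ) → ℕ → ℕ → Set
  Fixes f n k = ∀ x → iter f k x ≡ x [ n ]

  module SkewProperties {f : ℤ → ℤ} {π : ℤ → ℕ} {M′ : ℕ} {n : ℕ} (S : Skew f π M′ n) where
    open Skew S
    open Mod n

    iter-cong : ∀ k → x ≡ y [ n ] → iter f k x ≡ iter f k y [ n ]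
    iter-cong zero    e = e
    iter-cong (suc k) e = cong-mod (iter-cong k e)

    iter-zero : ∀ k → iter f k 0ℤ ≡ 0ℤ [ n ]
    iter-zero zero    = mod-refl
    iter-zero (suc k) = mod-trans (cong-mod (iter-zero k)) zero-mod

    iter-skew : ∀ k x y → iter f k (x + y) ≡ iter f k x + iter f (σ f π x k) y [ n ]
    iter-skew zero    x y = mod-refl
    iter-skew (suc k) x y = begin
      f (iter f k (x + y))                                               ≈⟨ cong-mod (iter-skew k x y) ⟩
      f (iter f k x + iter f (σ f π x k) y)                              ≈⟨ skew _ _ ⟩
      f (iter f k x) + iter f (π (iter f k x)) (iter f (σ f π x k) y)
        ≡⟨ cong (λ t → f (iter f k x) + t) (iter-+ f (π (iter f k x)) _ y) ⟨
      f (iter f k x) + iter f (π (iter f k x) ℕ.+ σ f π x k) y           ∎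

    fixes-+ : ∀ i j → Fixes f n i → Fixes f n j → Fixes f n (i ℕ.+ j)
    fixes-+ i j pi pj x = begin
      iter f (i ℕ.+ j) x      ≡⟨ iter-+ f i j x ⟩
      iter f i (iter f j x)   ≈⟨ pi _ ⟩
      iter f j x              ≈⟨ pj x ⟩
      x                       ∎

    fixes-sub : ∀ i j → Fixes f n i → Fixes f n (i ℕ.+ j) → Fixes f n j
    fixes-sub i j pi pij x = begin
      iter f j x              ≈⟨ pi _ ⟨
      iter f i (iter f j x)   ≡⟨ iter-+ f i j x ⟨
      iter f (i ℕ.+ j) x      ≈⟨ pij x ⟩
      x                       ∎

    fixes-* : ∀ q {k} → Fixes f n k → Fixes f n (q ℕ.* k)
    fixes-* zero        pk = λ _ → mod-refl
    fixes-* (suc q) {k} pk = fixes-+ k (q ℕ.* k) pk (fixes-* q pk)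

    iter-% : ∀ {m} .{{_ : ℕ.NonZero m}} → Fixes f n m → ∀ i x → iter f i x ≡ iter f (i ℕ.% m) x [ n ]
    iter-% {m} fixes i x = begin
      iter f i x  ≡⟨ cong (λ t → iter f t x) (trans (ℕ/.m≡m%n+[m/n]*n i m) (ℕₚ.+-comm (i ℕ.% m) _)) ⟩
      iter f ((i ℕ./ m) ℕ.* m ℕ.+ i ℕ.% m) x                ≡⟨ iter-+ f ((i ℕ./ m) ℕ.* m) (i ℕ.% m) x ⟩
      iter f ((i ℕ./ m) ℕ.* m) (iter f (i ℕ.% m) x)         ≈⟨ fixes-* (i ℕ./ m) fixes _ ⟩
      iter f (i ℕ.% m) x                                    ∎

    fixes-from-residues : ∀ k .{{_ : ℕ.NonZero n}} →
      (∀ (a : Fin n) → iter f k (+ toℕ a) ≡ + toℕ a [ n ]) → Fixes f n k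
    fixes-from-residues k pk x = begin
      iter f k x                        ≈⟨ iter-cong k (residue-≡ n x) ⟩
      iter f k (+ toℕ (residue n x))    ≈⟨ pk (residue n x) ⟩
      + toℕ (residue n x)               ≈⟨ residue-≡ n x ⟨
      x                                 ∎

    -- The inverse of `f^k` is `f^(k M′)`, since `k + k M′` is a multiple of the period `suc M′`.
    iter-inj : ∀ k → iter f k x ≡ iter f k y [ n ] → x ≡ y [ n ]
    iter-inj {x} {y} k e = begin
      x                                ≈⟨ undo x ⟨
      iter f (k ℕ.* M′) (iter f k x)   ≈⟨ iter-cong (k ℕ.* M′) e ⟩
      iter f (k ℕ.* M′) (iter f k y)   ≈⟨ undo y ⟩
      y                                ∎
      where
      undo : ∀ x → iter f (k ℕ.* M′) (iter f k x) ≡ x [ n ]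
      undo x = begin
        iter f (k ℕ.* M′) (iter f k x)  ≡⟨ iter-+ f (k ℕ.* M′) k x ⟨
        iter f (k ℕ.* M′ ℕ.+ k) x       ≡⟨ cong (λ t → iter f t x) (trans (ℕₚ.+-comm _ k) (sym (ℕₚ.*-suc k M′))) ⟩
        iter f (k ℕ.* suc M′) x         ≈⟨ fixes-* k {suc M′} period x ⟩
        x                               ∎

    fixes? : .{{_ : ℕ.NonZero n}} → ∀ k → Dec (Fixes f n k)
    fixes? k with Finₚ.all? (λ a → mod-dec n (iter f k (+ toℕ a)) (+ toℕ a))
    ... | yes pk = yes (fixes-from-residues k pk)
    ... | no ¬pk = no λ pk → ¬pk λ a → pk (+ toℕ a)

    opaque
      order : .{{_ : ℕ.NonZero n}} → Generator (Fixes f n)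
      order = generator (Fixes f n) fixes? (λ _ → mod-refl) fixes-+ fixes-sub M′ period

    -- Putting `y = 0` identifies `C` with `f c`, so membership in the kernel can be shown with
    -- whatever constant a computation produces.
    ker-intro : ∀ c C → (∀ y → f (c + y) ≡ C + f y [ n ]) → Ker f n c
    ker-intro c C e y = begin
      f (c + y)    ≈⟨ e y ⟩
      C + f y      ≈⟨ mod-+ʳ (f y) C≡fc ⟩
      f c + f y    ∎
      where
      C≡fc : C ≡ f c [ n ]
      C≡fc = begin
        C            ≡⟨ ℤₚ.+-identityʳ C ⟨
        C + 0ℤ       ≈⟨ mod-+ˡ C zero-mod ⟨
        C + f 0ℤ     ≈⟨ e 0ℤ ⟨
        f (c + 0ℤ)   ≡⟨ cong f (ℤₚ.+-identityʳ c) ⟩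
        f c          ∎

    ker-cong : ∀ {c d} → c ≡ d [ n ] → Ker f n c → Ker f n d
    ker-cong {c} {d} e kc = ker-intro d (f c) λ y → begin
      f (d + y)    ≈⟨ cong-mod (mod-+ʳ y e) ⟨
      f (c + y)    ≈⟨ kc y ⟩
      f c + f y    ∎

    ker-multiple : ∀ {c} → Ker f n c → ∀ k y → f (+ k * c + y) ≡ + k * f c + f y [ n ]
    ker-multiple {c} kc zero    y = mod-reflexive (trans (cong f (lemma c y)) (sym (lemma (f c) (f y))))
      where
      lemma : ∀ c y → 0ℤ * c + y ≡ y
      lemma = solve-∀
    ker-multiple {c} kc (suc k) y = begin
      f (+ suc k * c + y)        ≡⟨ cong (λ t → f (t * c + y)) (pos-+ 1 k) ⟩
      f ((1ℤ + + k) * c + y)     ≡⟨ cong f (lemma (+ k) c y) ⟩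
      f (c + (+ k * c + y))      ≈⟨ kc _ ⟩
      f c + f (+ k * c + y)      ≈⟨ mod-+ˡ (f c) (ker-multiple kc k y) ⟩
      f c + (+ k * f c + f y)    ≡⟨ lemma (+ k) (f c) (f y) ⟨
      (1ℤ + + k) * f c + f y     ≡⟨ cong (λ t → t * f c + f y) (pos-+ 1 k) ⟨
      + suc k * f c + f y        ∎
      where
      lemma : ∀ k c y → (1ℤ + k) * c + y ≡ c + (k * c + y)
      lemma = solve-∀

    ker-* : ∀ {c} k → Ker f n c → Ker f n (+ k * c)
    ker-* {c} k kc = ker-intro (+ k * c) (+ k * f c) (ker-multiple kc k)

    ker-neg : ∀ {c} → Ker f n c → Ker f n (- c)
    ker-neg {c} kc = ker-intro (- c) (- f c) λ y → mod-cancelˡ (f c) (begin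
      f c + f (- c + y)       ≈⟨ kc _ ⟨
      f (c + (- c + y))       ≡⟨ cong f (lemma c y) ⟩
      f y                     ≡⟨ lemma (f c) (f y) ⟨
      f c + (- f c + f y)     ∎)
      where
      lemma : ∀ c y → c + (- c + y) ≡ y
      lemma = solve-∀

  -- Nontriviality of the kernel

  iter-gap : ∀ {f π M′} (S : Skew f π M′ n) i d x → iter f (i ℕ.+ d) x ≡ iter f i x [ n ] → iter f d x ≡ x [ n ]
  iter-gap {f = f} S i d x e = SkewProperties.iter-inj S i (mod-trans (mod-reflexive (sym (iter-+ f i d x))) e)

  ∣<⇒zero : ∀ {m d} .{{_ : ℕ.NonZero m}} → m ℕ∣.∣ d → d ℕ.< m → d ≡ 0
  ∣<⇒zero {d = zero}  _ _   = refl
  ∣<⇒zero {d = suc d} m∣d d<m = contradiction m∣d (ℕ∣.>⇒∤ d<m)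

  -- As g divides a positive number below n, the index n / g is at least 2 and has a prime factor q.
  -- The subgroup generated by g then contains the one of order q, generated by `t g`.
  index-of-proper-divisor : ∀ c n {g} → 0 ℕ.< c → c ℕ.< n → g ℕ∣.∣ c → g ℕ∣.∣ n →
    ∃₂ λ q t → Prime q × n ≡ q ℕ.* (t ℕ.* g)
  index-of-proper-divisor c n {g} 0<c c<n g∣c (ℕ∣.divides h n≡hg) =
    let q , t , q-prime , h≡qt = prime-divisor h 2≤h
    in q , t , q-prime , trans n≡hg (trans (cong (ℕ._* g) h≡qt) (ℕₚ.*-assoc q t g))
    where
    2≤h : 2 ℕ.≤ h
    2≤h with h ℕₚ.≤? 1
    ... | no h≰1 = ℕₚ.≰⇒> h≰1
    ... | yes h≤1 = contradiction
        (ℕₚ.≤-trans (ℕₚ.≤-reflexive n≡hg) (ℕₚ.≤-trans (ℕₚ.*-monoˡ-≤ g h≤1)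
          (ℕₚ.≤-trans (ℕₚ.≤-reflexive (ℕₚ.*-identityˡ g)) (ℕ∣.∣⇒≤ {{ℕ.>-nonZero 0<c}} g∣c))))
        (ℕₚ.<⇒≱ c<n)

  module KernelNontrivial {f : ℤ → ℤ} {π : ℤ → ℕ} {M′ n : ℕ} (S : Skew f π M′ n) .{{_ : ℕ.NonZero n}} (1<n : 1 ℕ.< n) where
    open Skew S
    open SkewProperties S
    open Mod n
    open Generator order

    private
      instance
        m-nonZero : ℕ.NonZero m
        m-nonZero = m≢0

      opaque
        orbit : Generator (λ k → iter f k 1ℤ ≡ 1ℤ [ n ])
        orbit = generator (λ k → iter f k 1ℤ ≡ 1ℤ [ n ]) (λ k → mod-dec n (iter f k 1ℤ) 1ℤ) mod-refl add sub M′ (period 1ℤ)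
          where
          add : ∀ i j → iter f i 1ℤ ≡ 1ℤ [ n ] → iter f j 1ℤ ≡ 1ℤ [ n ] → iter f (i ℕ.+ j) 1ℤ ≡ 1ℤ [ n ]
          add i j pi pj = begin
            iter f (i ℕ.+ j) 1ℤ     ≡⟨ iter-+ f i j 1ℤ ⟩
            iter f i (iter f j 1ℤ)  ≈⟨ iter-cong i pj ⟩
            iter f i 1ℤ             ≈⟨ pi ⟩
            1ℤ                      ∎
          sub : ∀ i j → iter f i 1ℤ ≡ 1ℤ [ n ] → iter f (i ℕ.+ j) 1ℤ ≡ 1ℤ [ n ] → iter f j 1ℤ ≡ 1ℤ [ n ]
          sub i j pi pij = iter-gap S i j 1ℤ (mod-trans pij (mod-sym pi))

      open Generator orbit using ()
        renaming (m to k; member to k-member; minimal to k-minimal)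

      s : ℕ
      s = σ f π 1ℤ k

      iter-k-shift : ∀ j b → iter f (j ℕ.* k) (1ℤ + b) ≡ 1ℤ + iter f (j ℕ.* s) b [ n ]
      iter-k-shift zero    b = mod-refl
      iter-k-shift (suc j) b = begin
        iter f (k ℕ.+ j ℕ.* k) (1ℤ + b)             ≡⟨ iter-+ f k (j ℕ.* k) _ ⟩
        iter f k (iter f (j ℕ.* k) (1ℤ + b))        ≈⟨ iter-cong k (iter-k-shift j b) ⟩
        iter f k (1ℤ + iter f (j ℕ.* s) b)          ≈⟨ iter-skew k 1ℤ _ ⟩
        iter f k 1ℤ + iter f s (iter f (j ℕ.* s) b) ≈⟨ mod-+ʳ (iter f s (iter f (j ℕ.* s) b)) k-member ⟩
        1ℤ + iter f s (iter f (j ℕ.* s) b)          ≡⟨ cong (λ t → 1ℤ + t) (iter-+ f s (j ℕ.* s) b) ⟨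
        1ℤ + iter f (s ℕ.+ j ℕ.* s) b               ∎

      -- Conjugation by the translation x ↦ 1 + x turns f^k into f^s, so both have the
      -- same order m / k, and therefore k ∣ s.
      k∣s : k ℕ∣.∣ s
      k∣s with k-minimal m (member 1ℤ)
      ... | ℕ∣.divides q m≡qk = ℕ∣.*-cancelˡ-∣ q {{ℕₚ.m*n≢0⇒m≢0 q {k} {{subst ℕ.NonZero m≡qk m≢0}}}}
          (subst (ℕ∣._∣ q ℕ.* s) m≡qk (minimal (q ℕ.* s) fixes-qs))
        where
        fixes-qs : Fixes f n (q ℕ.* s)
        fixes-qs b = mod-cancelˡ 1ℤ (begin
          1ℤ + iter f (q ℕ.* s) b     ≈⟨ iter-k-shift q b ⟨
          iter f (q ℕ.* k) (1ℤ + b)   ≡⟨ cong (λ t → iter f t (1ℤ + b)) m≡qk ⟨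
          iter f m (1ℤ + b)           ≈⟨ member _ ⟩
          1ℤ + b                      ∎)

      -- Induction on representatives: `f^k (1 + b) = 1 + f^s b`, and `f^s` fixes b whenever `f^k`
      -- does, because `k ∣ s`.
      k-fixes : Fixes f n k
      k-fixes = fixes-from-residues k λ a → fixes-ℕ (toℕ a)
        where
        fixes-multiple : ∀ {b} j → iter f k b ≡ b [ n ] → iter f (j ℕ.* k) b ≡ b [ n ]
        fixes-multiple zero    e = mod-refl
        fixes-multiple {b} (suc j) e = begin
          iter f (k ℕ.+ j ℕ.* k) b       ≡⟨ iter-+ f k (j ℕ.* k) b ⟩
          iter f k (iter f (j ℕ.* k) b)  ≈⟨ iter-cong k (fixes-multiple j e) ⟩
          iter f k b                     ≈⟨ e ⟩
          b                              ∎
        fixes-s : ∀ {b} → iter f k b ≡ b [ n ] → iter f s b ≡ b [ n ]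
        fixes-s {b} e = mod-trans
          (mod-reflexive (cong (λ t → iter f t b) (ℕ∣._∣_.equality k∣s)))
          (fixes-multiple (ℕ∣.quotient k∣s) e)
        fixes-suc : ∀ b → iter f k b ≡ b [ n ] → iter f k (1ℤ + b) ≡ 1ℤ + b [ n ]
        fixes-suc b e = mod-trans (iter-skew k 1ℤ b) (mod-+ k-member (fixes-s e))
        fixes-ℕ : ∀ b → iter f k (+ b) ≡ + b [ n ]
        fixes-ℕ zero    = iter-zero k
        fixes-ℕ (suc b) = fixes-suc (+ b) (fixes-ℕ b)

    order-from-orbit : ∀ j → iter f j 1ℤ ≡ 1ℤ [ n ] → m ℕ∣.∣ j
    order-from-orbit j e = ℕ∣.∣-trans (minimal k k-fixes) (k-minimal j e)

    -- Zero is fixed and so lies off the orbit of 1. Together with the m points of that orbit it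
    -- gives `m + 1` distinct residues.
    order<n : m ℕ.< n
    order<n with m ℕₚ.<? n
    ... | yes m<n = m<n
    ... | no  m≮n = contradiction collision (¬collision)
      where
      orbit-point : Fin (suc m) → Fin n
      orbit-point Fin.zero    = residue n 0ℤ
      orbit-point (Fin.suc i) = residue n (iter f (toℕ i) 1ℤ)
      collision = Finₚ.pigeonhole (s≤s (ℕₚ.≮⇒≥ m≮n)) orbit-point
      same-residue : ∀ x y → residue n x ≡ residue n y → x ≡ y [ n ]
      same-residue x y e = begin
        x                      ≈⟨ residue-≡ n x ⟩
        + toℕ (residue n x)    ≡⟨ cong (+_ ∘ toℕ) e ⟩
        + toℕ (residue n y)    ≈⟨ residue-≡ n y ⟨
        y                      ∎
      ¬collision : ¬ (∃₂ λ i j → i Fin.< j × orbit-point i ≡ orbit-point j)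
      ¬collision (Fin.zero , Fin.suc j , _ , e) =
        contradiction (ℕ-≡⇒∣ 0 1 (iter-inj (toℕ j) (mod-trans (mod-sym (same-residue 0ℤ (iter f (toℕ j) 1ℤ) e)) (mod-sym (iter-zero (toℕ j))))))
          (ℕ∣.>⇒∤ 1<n)
      ¬collision (Fin.suc i , Fin.suc j , s≤s i<j , e) =
        ℕₚ.m>n⇒m∸n≢0 i<j (∣<⇒zero (order-from-orbit (toℕ j ℕ.∸ toℕ i) (iter-gap S (toℕ i) _ 1ℤ
            (mod-trans (mod-reflexive (cong (λ t → iter f t 1ℤ) (ℕₚ.m+[n∸m]≡n (ℕₚ.<⇒≤ i<j)))) (mod-sym (same-residue (iter f (toℕ i) 1ℤ) (iter f (toℕ j) 1ℤ) e)))))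
          (ℕₚ.≤-<-trans (ℕₚ.m∸n≤m (toℕ j) (toℕ i)) (Finₚ.toℕ<n j)))

    -- Both `b + (y − a)` and `a + (y − a)` are expanded with the same iterate of `y − a`, which
    -- cancels on comparison.
    ker-difference : ∀ a b → π a ℕ.% m ≡ π b ℕ.% m → Ker f n (b - a)
    ker-difference a b e = ker-intro (b - a) (f b - f a) λ y → begin
      f (b - a + y)                                   ≡⟨ cong f (lemma₁ a b y) ⟩
      f (b + (y - a))                                 ≈⟨ skew b (y - a) ⟩
      f b + iter f (π b) (y - a)                      ≈⟨ mod-+ˡ (f b) (iter-% {m} member (π b) (y - a)) ⟩
      f b + iter f (π b ℕ.% m) (y - a)                ≡⟨ cong (λ t → f b + iter f t (y - a)) e ⟨
      f b + iter f (π a ℕ.% m) (y - a)                ≈⟨ mod-+ˡ (f b) (iter-% {m} member (π a) (y - a)) ⟨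
      f b + iter f (π a) (y - a)                      ≡⟨ lemma₂ (f a) (f b) (iter f (π a) (y - a)) ⟩
      f b - f a + (f a + iter f (π a) (y - a))        ≈⟨ mod-+ˡ (f b - f a) (skew a (y - a)) ⟨
      f b - f a + f (a + (y - a))                     ≡⟨ cong (λ t → f b - f a + f t) (lemma₃ a y) ⟩
      f b - f a + f y                                 ∎
      where
      lemma₁ : ∀ a b y → b - a + y ≡ b + (y - a)
      lemma₁ = solve-∀
      lemma₂ : ∀ a b t → b + t ≡ b - a + (a + t)
      lemma₂ = solve-∀
      lemma₃ : ∀ a y → a + (y - a) ≡ y
      lemma₃ = solve-∀

    ker-gcd : ∀ c → Ker f n (+ c) → Ker f n (+ gcd c n)
    ker-gcd c kc with Bézout.identity (gcd-GCD c n)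
    ... | Bézout.+- i j eq = ker-cong (mod-sym (by (- + j) (bézout c i j (gcd c n) eq))) (ker-* i kc)
      where
      bézout : ∀ c i j g → g ℕ.+ j ℕ.* n ≡ i ℕ.* c → + g ≡ + i * + c + (- + j) * + n
      bézout c i j g eq = trans (lemma (+ g) (+ j) (+ n)) (cong (λ t → t + (- + j) * + n)
        (trans (cong (λ t → + g + t) (sym (pos-* j n))) (trans (sym (pos-+ g (j ℕ.* n))) (trans (cong +_ eq) (pos-* i c)))))
        where
        lemma : ∀ g j n → g ≡ g + j * n + (- j) * n
        lemma = solve-∀
    ... | Bézout.-+ i j eq = ker-cong (mod-sym (by (+ j) (bézout c i j (gcd c n) eq))) (ker-neg (ker-* i kc))
      where
      bézout : ∀ c i j g → g ℕ.+ i ℕ.* c ≡ j ℕ.* n → + g ≡ - (+ i * + c) + + j * + n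
      bézout c i j g eq = trans (lemma (+ g) (+ i * + c)) (cong (λ t → - (+ i * + c) + t)
        (trans (cong (λ t → + g + t) (sym (pos-* i c))) (trans (sym (pos-+ g (i ℕ.* c))) (trans (cong +_ eq) (pos-* j n)))))
        where
        lemma : ∀ g t → g ≡ - t + (g + t)
        lemma = solve-∀

    opaque
      small-kernel-element : ∃ λ c → 0 ℕ.< c × c ℕ.< n × Ker f n (+ c)
      small-kernel-element =
        let a , b , a<b , e = Finₚ.pigeonhole order<n (λ (a : Fin n) → fromℕ< (ℕ/.m%n<n (π (+ toℕ a)) m))
        in toℕ b ℕ.∸ toℕ a , ℕₚ.m<n⇒0<n∸m a<b
         , ℕₚ.≤-<-trans (ℕₚ.m∸n≤m (toℕ b) (toℕ a)) (Finₚ.toℕ<n b)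
         , subst (Ker f n) (trans (ℤₚ.m-n≡m⊖n (toℕ b) (toℕ a)) (ℤₚ.⊖-≥ (ℕₚ.<⇒≤ a<b)))
             (ker-difference (+ toℕ a) (+ toℕ b) (Finₚ.fromℕ<-injective _ _ _ _ e))

    prime-index : ∃₂ λ q d → Prime q × n ≡ q ℕ.* d × Ker f n (+ d)
    prime-index =
      let c , 0<c , c<n , kc = small-kernel-element
          q , t , q-prime , n≡q[tg] = index-of-proper-divisor c n 0<c c<n (gcd[m,n]∣m c n) (gcd[m,n]∣n c n)
      in q , t ℕ.* gcd c n , q-prime , n≡q[tg]
       , subst (Ker f n) (sym (pos-* t (gcd c n))) (ker-* t (ker-gcd c kc))

  -- Quotients by subgroups of prime order

  mod-scaleʳ : ∀ {q} d → x ≡ y [ q ] → x * + d ≡ y * + d [ q ℕ.* d ]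
  mod-scaleʳ {x} {y} {q} d e = subst₂ (λ s t → s ≡ t [ q ℕ.* d ]) (ℤₚ.*-comm (+ d) x) (ℤₚ.*-comm (+ d) y)
    (subst (λ n → + d * x ≡ + d * y [ n ]) (ℕₚ.*-comm d q) (mod-scale d e))

  mod-unscaleʳ : ∀ {q} d .{{_ : ℕ.NonZero d}} → x * + d ≡ y * + d [ q ℕ.* d ] → x ≡ y [ q ]
  mod-unscaleʳ {x} {y} {q} d e = mod-unscale d (subst (λ n → + d * x ≡ + d * y [ n ]) (ℕₚ.*-comm q d)
    (subst₂ (λ s t → s ≡ t [ q ℕ.* d ]) (ℤₚ.*-comm x (+ d)) (ℤₚ.*-comm y (+ d)) e))

  mod-multiple : ∀ x k → x + k * + n ≡ x [ n ]
  mod-multiple x k = by k refl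

  -- On each coset of the subgroup of order q generated by d, the map is affine with the common
  -- slope r, which matters only mod q.
  Fibre : (ℤ → ℤ) → ℕ → ℕ → ℤ → Set
  Fibre f q d r = ∀ y j → f (y + j * + d) ≡ f y + r * j * + d [ q ℕ.* d ]

  fibre-cong : ∀ {f q d r s} → r ≡ s [ q ] → Fibre f q d r → Fibre f q d s
  fibre-cong {f} {q} {d} e fib y j = mod-trans (fib y j) (mod-+ˡ (f y) (mod-scaleʳ d (mod-*ʳ j e)))

  opaque
    -- Additivity on the kernel gives `q f(d) = f(q d) = 0`, so `f(d)` is a multiple `r d`. The
    -- subgroup is therefore invariant and `f` descends.
    quotient-step : ∀ {f π M′ q d} .{{_ : ℕ.NonZero q}} → Skew f π M′ (q ℕ.* d) → Ker f (q ℕ.* d) (+ d) →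
      Skew f π M′ d × ∃ (Fibre f q d)
    quotient-step {f} {π} {M′} {q} {d} S kd = quotient-skew , r , shift
      where
      open Skew S
      open SkewProperties S
      open Mod (q ℕ.* d)
      fd≡0 : f (+ d) ≡ 0ℤ [ d ]
      fd≡0 = mod-unscale q (begin
        + q * f (+ d)               ≡⟨ ℤₚ.+-identityʳ _ ⟨
        + q * f (+ d) + 0ℤ          ≈⟨ mod-+ˡ (+ q * f (+ d)) zero-mod ⟨
        + q * f (+ d) + f 0ℤ        ≈⟨ ker-multiple kd q 0ℤ ⟨
        f (+ q * + d + 0ℤ)          ≡⟨ cong (λ t → f (t + 0ℤ)) (pos-* q d) ⟨
        f (+ (q ℕ.* d) + 0ℤ)        ≈⟨ cong-mod (by 1ℤ (lemma (+ (q ℕ.* d)))) ⟩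
        f 0ℤ                        ≈⟨ zero-mod ⟩
        0ℤ                          ≡⟨ ℤₚ.*-zeroʳ (+ q) ⟨
        + q * 0ℤ                    ∎)
        where
        lemma : ∀ x → x + 0ℤ ≡ 0ℤ + 1ℤ * x
        lemma = solve-∀
      r : ℤ
      r = _≡_[_].quotient fd≡0
      fd≡rd : f (+ d) ≡ r * + d
      fd≡rd = trans (_≡_[_].equality fd≡0) (ℤₚ.+-identityˡ _)
      shift : Fibre f q d r
      shift y j = begin
        f (y + j * + d)          ≈⟨ cong-mod (mod-+ˡ y (mod-scaleʳ d j≡k)) ⟩
        f (y + + k * + d)        ≡⟨ cong f (ℤₚ.+-comm y (+ k * + d)) ⟩
        f (+ k * + d + y)        ≈⟨ ker-multiple kd k y ⟩
        + k * f (+ d) + f y      ≡⟨ cong (λ t → + k * t + f y) fd≡rd ⟩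
        + k * (r * + d) + f y    ≡⟨ lemma (+ k) r (+ d) (f y) ⟩
        f y + r * + k * + d      ≈⟨ mod-+ˡ (f y) (mod-scaleʳ d (mod-*ˡ r j≡k)) ⟨
        f y + r * j * + d        ∎
        where
        k : ℕ
        k = toℕ (residue q j)
        j≡k : j ≡ + k [ q ]
        j≡k = residue-≡ q j
        lemma : ∀ k r d u → k * (r * d) + u ≡ u + r * k * d
        lemma = solve-∀
      quotient-skew : Skew f π M′ d
      quotient-skew = record
        { cong-mod = λ { {y = y} (by k refl) → mod-trans (mod-coarsen q (shift y k)) (mod-multiple (f y) (r * k)) }
        ; zero-mod = mod-coarsen q zero-mod
        ; skew     = λ x y → mod-coarsen q (skew x y)
        ; period   = λ x → mod-coarsen q (period x)
        }

  module FibreProperties {f : ℤ → ℤ} {π : ℤ → ℕ} {M′ q d : ℕ} {r : ℤ} (S : Skew f π M′ (q ℕ.* d)) (fib : Fibre f q d r) where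
    open Skew S
    open SkewProperties S
    open Mod (q ℕ.* d)

    multiplier≢0 : .{{_ : ℕ.NonZero d}} → 1 ℕ.< q → ¬ r ≡ 0ℤ [ q ]
    multiplier≢0 1<q r≡0 = contradiction (m⇒∣ 1≡0) (ℕ∣.>⇒∤ 1<q)
      where
      lemma : ∀ r d u → u + r * 1ℤ * d ≡ u + r * d
      lemma = solve-∀
      1≡0 : 1ℤ ≡ 0ℤ [ q ]
      1≡0 = mod-unscaleʳ d (iter-inj 1 (begin
        f (1ℤ * + d)             ≡⟨ cong f (ℤₚ.+-identityˡ (1ℤ * + d)) ⟨
        f (0ℤ + 1ℤ * + d)        ≈⟨ fib 0ℤ 1ℤ ⟩
        f 0ℤ + r * 1ℤ * + d      ≡⟨ lemma r (+ d) (f 0ℤ) ⟩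
        f 0ℤ + r * + d           ≈⟨ mod-+ˡ (f 0ℤ) (mod-scaleʳ d r≡0) ⟩
        f 0ℤ + 0ℤ                ≡⟨ ℤₚ.+-identityʳ (f 0ℤ) ⟩
        f 0ℤ                     ≡⟨ cong f (ℤₚ.*-zeroˡ (+ d)) ⟨
        f (0ℤ * + d)             ∎))

    iter-shift : ∀ i y j → iter f i (y + j * + d) ≡ iter f i y + r ^ i * j * + d [ q ℕ.* d ]
    iter-shift zero    y j = mod-reflexive (cong (λ t → y + t * + d) (sym (ℤₚ.*-identityˡ j)))
    iter-shift (suc i) y j = begin
      f (iter f i (y + j * + d))                    ≈⟨ cong-mod (iter-shift i y j) ⟩
      f (iter f i y + r ^ i * j * + d)              ≈⟨ fib _ _ ⟩
      f (iter f i y) + r * (r ^ i * j) * + d        ≡⟨ cong (λ t → f (iter f i y) + t * + d) (ℤₚ.*-assoc r (r ^ i) j) ⟨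
      f (iter f i y) + r * r ^ i * j * + d          ∎

    -- `f^D` moves x inside its fibre, and `r^D = 1` makes every further application of `f^D` add
    -- the same displacement.
    iter-power : ∀ D → Fixes f d D → r ^ D ≡ 1ℤ [ q ] →
      ∀ k x → iter f (k ℕ.* D) x ≡ x + + k * (iter f D x - x) [ q ℕ.* d ]
    iter-power D fixes rᴰ≡1 k x with fixes x
    ... | by δ eq = mod-trans (power k) (mod-reflexive (cong (λ t → x + + k * t)
          (trans (lemma₀ x (δ * + d)) (cong (λ t → t - x) (sym eq)))))
      where
      lemma₀ : ∀ x t → t ≡ x + t - x
      lemma₀ = solve-∀
      lemma₁ : ∀ x t → x ≡ x + 0ℤ * t
      lemma₁ = solve-∀
      lemma₂ : ∀ x k δ d → x + δ * d + k * δ * d ≡ x + (1ℤ + k) * (δ * d)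
      lemma₂ = solve-∀
      power : ∀ k → iter f (k ℕ.* D) x ≡ x + + k * (δ * + d) [ q ℕ.* d ]
      power zero    = mod-reflexive (lemma₁ x (δ * + d))
      power (suc k) = begin
        iter f (D ℕ.+ k ℕ.* D) x                 ≡⟨ iter-+ f D (k ℕ.* D) x ⟩
        iter f D (iter f (k ℕ.* D) x)            ≈⟨ iter-cong D (power k) ⟩
        iter f D (x + + k * (δ * + d))           ≡⟨ cong (λ t → iter f D (x + t)) (ℤₚ.*-assoc (+ k) δ (+ d)) ⟨
        iter f D (x + + k * δ * + d)             ≈⟨ iter-shift D x (+ k * δ) ⟩
        iter f D x + r ^ D * (+ k * δ) * + d     ≈⟨ mod-+ˡ (iter f D x) (mod-scaleʳ d (mod-*ʳ (+ k * δ) rᴰ≡1)) ⟩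
        iter f D x + 1ℤ * (+ k * δ) * + d        ≡⟨ cong₂ (λ s t → s + t * + d) eq (ℤₚ.*-identityˡ (+ k * δ)) ⟩
        x + δ * + d + + k * δ * + d              ≡⟨ lemma₂ x (+ k) δ (+ d) ⟩
        x + (1ℤ + + k) * (δ * + d)               ≡⟨ cong (λ t → x + t * (δ * + d)) (pos-+ 1 k) ⟨
        x + + suc k * (δ * + d)                  ∎

  -- Quotients by the involution and lifting of the kernel

  parity : ∀ x → x ≡ 0ℤ [ 2 ] ⊎ x ≡ 1ℤ [ 2 ]
  parity x with residue 2 x | residue-≡ 2 x
  ... | Fin.zero          | e = inj₁ e
  ... | Fin.suc Fin.zero  | e = inj₂ e

  opaque
    binary-quotient : ∀ {f π M′ d} .{{_ : ℕ.NonZero d}} → Skew f π M′ (2 ℕ.* d) → Ker f (2 ℕ.* d) (+ d) →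
      Skew f π M′ d × Fibre f 2 d 1ℤ
    binary-quotient {f} {d = d} S kd with quotient-step {q = 2} {d} S kd
    ... | S′ , r , fib with parity r
    ...   | inj₁ r≡0 = contradiction r≡0 (FibreProperties.multiplier≢0 {q = 2} {d} {r} S fib (s≤s (s≤s z≤n)))
    ...   | inj₂ r≡1 = S′ , fibre-cong {f} {q = 2} {d} {r} {1ℤ} r≡1 fib

  -- If K ≤ ℤ/2d has order 2, then N = K⟨f^m⟩, with m the order of f mod d, is a 2-group of
  -- order at most 4, so that an element of odd order of ℤ/2d centralises N. This is what
  -- lifts the subgroup generated by u from the kernel mod d to the kernel mod 2d.
  module KernelLift {f : ℤ → ℤ} {π : ℤ → ℕ} {M′ d : ℕ} .{{_ : ℕ.NonZero d}} (S : Skew f π M′ (2 ℕ.* d))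
    (kd : Ker f (2 ℕ.* d) (+ d)) (u : ℤ) (ku : Ker f d u)
    (t : ℕ) (odd-order : + (suc (2 ℕ.* t)) * u ≡ 0ℤ [ 2 ℕ.* d ]) where
    open Skew S
    open SkewProperties S
    open Mod (2 ℕ.* d)

    private
      S′ : Skew f π M′ d
      S′ = proj₁ (binary-quotient {d = d} S kd)
      module S′ = SkewProperties S′

      fibre : Fibre f 2 d 1ℤ
      fibre = proj₂ (binary-quotient {d = d} S kd)

      open FibreProperties {q = 2} {d} {1ℤ} S fibre
      open Generator S′.order

      e : ℤ → ℤ
      e y = iter f m y - y

      iter-m : ∀ k y → iter f (k ℕ.* m) y ≡ y + + k * e y [ 2 ℕ.* d ]
      iter-m = iter-power m member (mod-reflexive (ℤₚ.^-zeroˡ m))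

      e≡0 : ∀ y → e y ≡ 0ℤ [ d ]
      e≡0 y = mod-trans (mod-+ʳ (- y) (member y)) (mod-reflexive (ℤₚ.+-inverseʳ y))

      even-multiple : ∀ {c} y → c ≡ 0ℤ [ 2 ] → c * e y ≡ 0ℤ [ 2 ℕ.* d ]
      even-multiple {c} y c≡0 with e≡0 y
      ... | by δ eq = begin
        c * e y             ≡⟨ cong (λ s → c * s) (trans eq (ℤₚ.+-identityˡ (δ * + d))) ⟩
        c * (δ * + d)       ≡⟨ ℤₚ.*-assoc c δ (+ d) ⟨
        c * δ * + d         ≈⟨ mod-scaleʳ d (mod-*ʳ δ c≡0) ⟩
        0ℤ * δ * + d        ≡⟨ lemma δ (+ d) ⟩
        0ℤ                  ∎
        where
        lemma : ∀ δ d → 0ℤ * δ * d ≡ 0ℤ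
        lemma = solve-∀

      f-step : ∀ k y → f (y + + k * e y) ≡ f y + + k * e y [ 2 ℕ.* d ]
      f-step k y with e≡0 y
      ... | by δ eq = begin
        f (y + + k * e y)           ≡⟨ cong (λ s → f (y + s)) ke ⟩
        f (y + + k * δ * + d)       ≈⟨ fibre y (+ k * δ) ⟩
        f y + 1ℤ * (+ k * δ) * + d  ≡⟨ cong (λ s → f y + s * + d) (ℤₚ.*-identityˡ (+ k * δ)) ⟩
        f y + + k * δ * + d         ≡⟨ cong (λ s → f y + s) ke ⟨
        f y + + k * e y             ∎
        where
        ke : + k * e y ≡ + k * δ * + d
        ke = trans (cong (λ s → + k * s) (trans eq (ℤₚ.+-identityˡ (δ * + d)))) (sym (ℤₚ.*-assoc (+ k) δ (+ d)))

      opaque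
        -- As u is in the kernel mod d, `f^(π u)` agrees with `f` mod d, so `π u − 1` is a multiple
        -- `j m` up to the period. In the computation `M′` plays the part of -1.
        twist : ∃ λ j → ∀ y → f (u + y) ≡ f u + (f y + + j * e y) [ 2 ℕ.* d ]
        twist = j , λ y → begin
          f (u + y)                              ≈⟨ skew u y ⟩
          f u + iter f (π u) y
            ≈⟨ mod-+ˡ (f u) (mod-trans (mod-sym (period _)) (mod-reflexive (sym (iter-+ f (suc M′) (π u) y)))) ⟩
          f u + f (iter f (M′ ℕ.+ π u) y)        ≡⟨ cong (λ k → f u + f (iter f k y)) eq ⟩
          f u + f (iter f (j ℕ.* m) y)           ≈⟨ mod-+ˡ (f u) (mod-trans (cong-mod (iter-m j y)) (f-step j y)) ⟩
          f u + (f y + + j * e y)                ∎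
          where
          fixes : Fixes f d (M′ ℕ.+ π u)
          fixes y = S′.iter-inj 1 (mod-trans (mod-reflexive (iter-+ f (suc M′) (π u) y))
            (mod-trans (Skew.period S′ _) (mod-cancelˡ (f u) (mod-trans (mod-sym (Skew.skew S′ u y)) (ku y)))))
          j : ℕ
          j = ℕ∣.quotient (minimal _ fixes)
          eq : M′ ℕ.+ π u ≡ j ℕ.* m
          eq = ℕ∣._∣_.equality (minimal _ fixes)

        -- Since `f^m` is trivial mod d, the exponent `σ f π u m` must act trivially mod d as well,
        -- and is thus a multiple of m.
        twist-m : ∃ λ q → ∀ y → e (u + y) ≡ e u + + q * e y [ 2 ℕ.* d ]
        twist-m = q , λ y → begin
          iter f m (u + y) - (u + y)                     ≈⟨ mod-+ʳ (- (u + y)) (iter-skew m u y) ⟩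
          iter f m u + iter f s y - (u + y)              ≡⟨ cong (λ k → iter f m u + iter f k y - (u + y)) eq ⟩
          iter f m u + iter f (q ℕ.* m) y - (u + y)      ≈⟨ mod-+ʳ (- (u + y)) (mod-+ˡ (iter f m u) (iter-m q y)) ⟩
          iter f m u + (y + + q * e y) - (u + y)         ≡⟨ lemma (iter f m u) u y (+ q * e y) ⟩
          e u + + q * e y                                ∎
          where
          s : ℕ
          s = σ f π u m
          fixes : Fixes f d s
          fixes y = mod-cancelˡ u (mod-trans (mod-sym (mod-+ʳ (iter f s y) (member u)))
            (mod-trans (mod-sym (S′.iter-skew m u y)) (member (u + y))))
          q : ℕ
          q = ℕ∣.quotient (minimal s fixes)
          eq : s ≡ q ℕ.* m
          eq = ℕ∣._∣_.equality (minimal s fixes)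
          lemma : ∀ a u y t → a + (y + t) - (u + y) ≡ a - u + t
          lemma = solve-∀

      j q : ℕ
      j = proj₁ twist
      q = proj₁ twist-m

      e-zero : e 0ℤ ≡ 0ℤ [ 2 ℕ.* d ]
      e-zero = mod-trans (mod-+ʳ (- 0ℤ) (iter-zero m)) (mod-reflexive refl)

      -- The values of `e` have order at most 2, so an even `1 + q` kills them. If q is even
      -- instead, `e (u + y) = e u` for all y; then `e` is constant, equal to `e 0 = 0`.
      obstruction : ∀ y → (1ℤ + + q) * e y ≡ 0ℤ [ 2 ℕ.* d ]
      obstruction y with parity (+ q)
      ... | inj₂ q≡1 = even-multiple y (mod-trans (mod-+ˡ 1ℤ q≡1) (by 1ℤ refl))
      ... | inj₁ q≡0 = mod-trans (mod-*ˡ (1ℤ + + q) e≡0ʸ) (mod-reflexive (ℤₚ.*-zeroʳ (1ℤ + + q)))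
        where
        e≡eu : ∀ y → e y ≡ e u [ 2 ℕ.* d ]
        e≡eu y = begin
          e y                          ≡⟨ cong e (lemma u y) ⟩
          e (u + (y - u))              ≈⟨ proj₂ twist-m (y - u) ⟩
          e u + + q * e (y - u)        ≈⟨ mod-+ˡ (e u) (even-multiple (y - u) q≡0) ⟩
          e u + 0ℤ                     ≡⟨ ℤₚ.+-identityʳ (e u) ⟩
          e u                          ∎
          where
          lemma : ∀ u y → y ≡ u + (y - u)
          lemma = solve-∀
        e≡0ʸ : e y ≡ 0ℤ [ 2 ℕ.* d ]
        e≡0ʸ = mod-trans (e≡eu y) (mod-trans (mod-sym (e≡eu 0ℤ)) e-zero)

      -- Applying `twist` twice leaves the error `j (1 + q) e y`, which is what `obstruction`
      -- removes.
      ker-double : Ker f (2 ℕ.* d) (u + u)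
      ker-double = ker-intro (u + u) (f u + f u + + j * e u) λ y → begin
        f (u + u + y)                                                        ≡⟨ cong f (ℤₚ.+-assoc u u y) ⟩
        f (u + (u + y))                                                      ≈⟨ proj₂ twist (u + y) ⟩
        f u + (f (u + y) + + j * e (u + y))  ≈⟨ mod-+ˡ (f u) (mod-+ (proj₂ twist y) (mod-*ˡ (+ j) (proj₂ twist-m y))) ⟩
        f u + (f u + (f y + + j * e y) + + j * (e u + + q * e y))            ≡⟨ lemma (f u) (f y) (+ j) (+ q) (e u) (e y) ⟩
        f u + f u + + j * e u + f y + + j * ((1ℤ + + q) * e y)
          ≈⟨ mod-+ˡ (f u + f u + + j * e u + f y) (mod-*ˡ (+ j) (obstruction y)) ⟩
        f u + f u + + j * e u + f y + + j * 0ℤ                               ≡⟨ lemma′ (f u + f u + + j * e u + f y) (+ j) ⟩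
        f u + f u + + j * e u + f y                                          ∎
        where
        lemma : ∀ a b j q s t →
          a + (a + (b + j * t) + j * (s + q * t)) ≡ a + a + j * s + b + j * ((1ℤ + q) * t)
        lemma = solve-∀
        lemma′ : ∀ a j → a + j * 0ℤ ≡ a
        lemma′ = solve-∀

    -- Odd order makes u a multiple of its double: `(t + 1) (u + u) = u + (2 t + 1) u = u`.
    kernel-lift : Ker f (2 ℕ.* d) u
    kernel-lift = ker-cong (begin
      + suc t * (u + u)              ≡⟨ cong (λ s → s * (u + u)) (pos-+ 1 t) ⟩
      (1ℤ + + t) * (u + u)           ≡⟨ lemma (+ t) u ⟩
      u + (1ℤ + + 2 * + t) * u       ≡⟨ cong (λ s → u + (1ℤ + s) * u) (pos-* 2 t) ⟨
      u + (1ℤ + + (2 ℕ.* t)) * u     ≡⟨ cong (λ s → u + s * u) (pos-+ 1 (2 ℕ.* t)) ⟨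
      u + + suc (2 ℕ.* t) * u        ≈⟨ mod-+ˡ u odd-order ⟩
      u + 0ℤ                         ≡⟨ ℤₚ.+-identityʳ u ⟩
      u                              ∎) (ker-* (suc t) ker-double)
      where
      lemma : ∀ t u → (1ℤ + t) * (u + u) ≡ u + (1ℤ + + 2 * t) * u
      lemma = solve-∀

  -- The subgroup of order p in the kernel on ℤ/2ᵏp

  prime∣prime : ∀ {q p} → Prime q → Prime p → q ℕ∣.∣ p → q ≡ p
  prime∣prime {q} pq pp q∣p with prime⇒irreducible pp q∣p
  ... | inj₁ q≡1 = contradiction (subst Prime q≡1 pq) ¬prime[1]
  ... | inj₂ q≡p = q≡p

  prime∣2^k*p : ∀ {q p} k → Prime q → Prime p → q ℕ∣.∣ 2 ℕ.^ k ℕ.* p → (q ≡ 2 × ∃ λ l → k ≡ suc l) ⊎ q ≡ p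
  prime∣2^k*p {q} {p} zero    pq pp d = inj₂ (prime∣prime pq pp (subst (q ℕ∣.∣_) (ℕₚ.*-identityˡ p) d))
  prime∣2^k*p {q} {p} (suc k) pq pp d
    with euclidsLemma 2 (2 ℕ.^ k ℕ.* p) pq (subst (q ℕ∣.∣_) (ℕₚ.*-assoc 2 (2 ℕ.^ k) p) d)
  ... | inj₁ q∣2 = inj₁ (prime∣prime pq prime[2] q∣2 , k , refl)
  ... | inj₂ d′ with prime∣2^k*p k pq pp d′
  ...   | inj₁ (q≡2 , _) = inj₁ (q≡2 , k , refl)
  ...   | inj₂ q≡p       = inj₂ q≡p

  module _ {f : ℤ → ℤ} {π : ℤ → ℕ} {M′ p : ℕ} (pp : Prime p) (t : ℕ) (odd : p ≡ suc (2 ℕ.* t)) where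

    -- Some subgroup of prime order q lies in the kernel. If `q = p`, it is the desired one. If
    -- `q = 2`, divide by it, use the statement for the exponent one lower, and return with
    -- `KernelLift`.
    odd-part-in-kernel : ∀ k → Skew f π M′ (2 ℕ.^ k ℕ.* p) → Ker f (2 ℕ.^ k ℕ.* p) (+ (2 ℕ.^ k))
    odd-part-in-kernel k S = lift k (KernelNontrivial.prime-index S 1<n) S
      where
      instance
        _ : ℕ.NonZero p
        _ = prime⇒nonZero pp
        2^k≢0 : ℕ.NonZero (2 ℕ.^ k)
        2^k≢0 = ℕₚ.m^n≢0 2 k
        n≢0 : ℕ.NonZero (2 ℕ.^ k ℕ.* p)
        n≢0 = ℕₚ.m*n≢0 (2 ℕ.^ k) p
      1<n : 1 ℕ.< 2 ℕ.^ k ℕ.* p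
      1<n = ℕₚ.<-≤-trans (ℕ.nonTrivial⇒n>1 p {{prime⇒nonTrivial pp}}) (ℕₚ.m≤n*m p (2 ℕ.^ k))
      lift : ∀ k → (∃₂ λ q d → Prime q × 2 ℕ.^ k ℕ.* p ≡ q ℕ.* d × Ker f (2 ℕ.^ k ℕ.* p) (+ d)) →
        Skew f π M′ (2 ℕ.^ k ℕ.* p) → Ker f (2 ℕ.^ k ℕ.* p) (+ (2 ℕ.^ k))
      lift k (q , d , pq , n≡qd , kd) S
        with prime∣2^k*p k pq pp (ℕ∣.divides d (trans n≡qd (ℕₚ.*-comm q d)))
      ... | inj₂ refl = subst (λ e → Ker f (2 ℕ.^ k ℕ.* p) (+ e))
            (ℕₚ.*-cancelˡ-≡ d (2 ℕ.^ k) p (trans (sym n≡qd) (ℕₚ.*-comm (2 ℕ.^ k) p))) kd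
      lift (suc l) (q , d , pq , n≡qd , kd) S | inj₁ (refl , _) =
        subst (λ n → Ker f n (+ (2 ℕ.^ suc l))) (sym n≡2d)
          (KernelLift.kernel-lift {d = 2 ℕ.^ l ℕ.* p} {{n′≢0}} S₂ k₂ (+ (2 ℕ.^ suc l)) k-quotient t odd-order)
        where
        n′≢0 : ℕ.NonZero (2 ℕ.^ l ℕ.* p)
        n′≢0 = ℕₚ.m*n≢0 (2 ℕ.^ l) p {{ℕₚ.m^n≢0 2 l}}
        n≡2d : 2 ℕ.^ suc l ℕ.* p ≡ 2 ℕ.* (2 ℕ.^ l ℕ.* p)
        n≡2d = ℕₚ.*-assoc 2 (2 ℕ.^ l) p
        d≡ : d ≡ 2 ℕ.^ l ℕ.* p
        d≡ = ℕₚ.*-cancelˡ-≡ d _ 2 (trans (sym n≡qd) n≡2d)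
        S₂ : Skew f π M′ (2 ℕ.* (2 ℕ.^ l ℕ.* p))
        S₂ = subst (Skew f π M′) n≡2d S
        k₂ : Ker f (2 ℕ.* (2 ℕ.^ l ℕ.* p)) (+ (2 ℕ.^ l ℕ.* p))
        k₂ = subst₂ (λ n e → Ker f n (+ e)) n≡2d d≡ kd
        S₁ : Skew f π M′ (2 ℕ.^ l ℕ.* p)
        S₁ = proj₁ (quotient-step {q = 2} {2 ℕ.^ l ℕ.* p} S₂ k₂)
        -- The quotient supplies `2^l`, but `KernelLift` needs an element of odd order mod
        -- `2^(l+1) p`. The double `2^(l+1)` is still in the kernel and has order p.
        k-quotient : Ker f (2 ℕ.^ l ℕ.* p) (+ (2 ℕ.^ suc l))
        k-quotient = subst (Ker f (2 ℕ.^ l ℕ.* p)) (sym (pos-* 2 (2 ℕ.^ l)))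
          (SkewProperties.ker-* S₁ 2 (odd-part-in-kernel l S₁))
        odd-order : + suc (2 ℕ.* t) * + (2 ℕ.^ suc l) ≡ 0ℤ [ 2 ℕ.* (2 ℕ.^ l ℕ.* p) ]
        odd-order = by 1ℤ (trans (cong (λ s → + s * + (2 ℕ.^ suc l)) (sym odd))
          (trans (sym (pos-* p (2 ℕ.^ suc l)))
          (trans (cong +_ (trans (ℕₚ.*-comm p (2 ℕ.^ suc l)) n≡2d))
            (sym (trans (ℤₚ.+-identityˡ _) (ℤₚ.*-identityˡ _))))))

  -- Skew morphisms of ℤ/16

  at : List ℕ → ℕ → ℕ
  at []       _       = 0
  at (x ∷ _)  zero    = x
  at (_ ∷ xs) (suc i) = at xs i

  -- The search over exponents is finite: when the k-th power is trivial, exponents count mod k, and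
  -- 0 stands for k.
  SkewTable : (n k : ℕ) .{{_ : ℕ.NonZero n}} → List ℕ → Set
  SkewTable n k t =
    All (λ a → Any (λ i → All (λ b →
      at t ((a ℕ.+ b) ℕ.% n) ≡ (at t a ℕ.+ iter (at t) i b) ℕ.% n) (upTo n)) (upTo k)) (upTo n)

  skewTable? : ∀ n k .{{_ : ℕ.NonZero n}} t → Dec (SkewTable n k t)
  skewTable? n k t = all? (λ a → any? (λ i → all? (λ b → _ ℕₚ.≟ _) (upTo n)) (upTo k)) (upTo n)

  -- This is `φ (φ x + y) − φ (φ x) = φ (x + y) − φ x`, that is, the powers of φ with exponents
  -- `π (φ x)` and `π x` agree. Terms are moved across the equality to avoid subtraction in ℕ.
  CosetTable : (n : ℕ) .{{_ : ℕ.NonZero n}} → List ℕ → Set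
  CosetTable n t =
    All (λ x → All (λ y →
      (at t ((at t x ℕ.+ y) ℕ.% n) ℕ.+ at t x) ℕ.% n ≡ (at t ((x ℕ.+ y) ℕ.% n) ℕ.+ at t (at t x)) ℕ.% n) (upTo n)) (upTo n)

  cosetTable? : ∀ n .{{_ : ℕ.NonZero n}} t → Dec (CosetTable n t)
  cosetTable? n t = all? (λ x → all? (λ y → _ ℕₚ.≟ _) (upTo n)) (upTo n)

  -- The involution d of ℤ/2d lies in the kernel and is fixed, so φ(x + d) = φ(x) + d: a table mod 2d
  -- is determined by its first half, which lifts the table mod d entry by entry.
  choices : ℕ → List ℕ → List (List ℕ)
  choices n []       = [] ∷ []
  choices n (x ∷ xs) = concatMap (λ ys → (x ∷ ys) ∷ (x ℕ.+ n ∷ ys) ∷ []) (choices n xs)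

  double : (n : ℕ) .{{_ : ℕ.NonZero (n ℕ.+ n)}} → List ℕ → List ℕ
  double n ys = ys ++ map (λ y → (y ℕ.+ n) ℕ.% (n ℕ.+ n)) ys

  lifts : (n k : ℕ) .{{_ : ℕ.NonZero (n ℕ.+ n)}} → List (List ℕ) → List (List ℕ)
  lifts n k ts = filter (skewTable? (n ℕ.+ n) k) (concatMap (λ t → map (double n) (choices n t)) ts)

  -- The root is the identity of ℤ/2. The exponent bounds 2, 4, 8 come from `fixes₄`, `fixes₈`,
  -- `fixes₁₆`, and a table mod n has `2^n` candidate lifts before filtering.
  tables₁₆ : List (List ℕ)
  tables₁₆ = lifts 8 8 (lifts 4 4 (lifts 2 2 ((0 ∷ 1 ∷ []) ∷ [])))

  opaque
    coset₁₆ : All (CosetTable 16) tables₁₆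
    coset₁₆ = from-yes (all? (cosetTable? 16) tables₁₆)

  two-power-quotient : ∀ {f π M′} k → Skew f π M′ (2 ℕ.^ suc k) →
    Skew f π M′ (2 ℕ.^ k) × Fibre f 2 (2 ℕ.^ k) 1ℤ
  two-power-quotient {f} k S = binary-quotient {d = 2 ℕ.^ k} S
    (let q , d , pq , n≡qd , kd = KernelNontrivial.prime-index S 1<n
         q≡2 = q≡2′ q d pq n≡qd
     in subst (λ e → Ker f (2 ℕ.^ suc k) (+ e))
          (sym (ℕₚ.*-cancelˡ-≡ (2 ℕ.^ k) d 2 (trans n≡qd (cong (ℕ._* d) q≡2)))) kd)
    where
    instance
      _ : ℕ.NonZero (2 ℕ.^ k)
      _ = ℕₚ.m^n≢0 2 k
      _ : ℕ.NonZero (2 ℕ.^ suc k)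
      _ = ℕₚ.m^n≢0 2 (suc k)
    1<n : 1 ℕ.< 2 ℕ.^ suc k
    1<n = ℕₚ.*-monoʳ-≤ 2 (ℕ.>-nonZero⁻¹ (2 ℕ.^ k))
    q≡2′ : ∀ q d → Prime q → 2 ℕ.^ suc k ≡ q ℕ.* d → q ≡ 2
    -- Applied with 2 in place of p, reading `2^(k+1)` as `2^k · 2`, so that both alternatives say
    -- `q = 2`.
    q≡2′ q d pq n≡qd with prime∣2^k*p k pq prime[2]
      (ℕ∣.divides d (trans (ℕₚ.*-comm (2 ℕ.^ k) 2) (trans n≡qd (ℕₚ.*-comm q d))))
    ... | inj₁ (q≡2 , _) = q≡2
    ... | inj₂ q≡2       = q≡2

  -- `f^D` moves x by a multiple of d, and `f^(2D)` by twice that multiple, which vanishes mod 2d.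
  fixes-double : ∀ {f π M′ d} → Skew f π M′ (2 ℕ.* d) → Fibre f 2 d 1ℤ →
    ∀ D → Fixes f d D → Fixes f (2 ℕ.* d) (2 ℕ.* D)
  fixes-double {f} {d = d} S fib D fixes x =
    mod-trans (FibreProperties.iter-power {q = 2} {d} {1ℤ} S fib D fixes (mod-reflexive (ℤₚ.^-zeroˡ D)) 2 x)
    (mod-trans (mod-+ˡ x (mod-scale 2 (mod-+ʳ (- x) (fixes x))))
    (mod-reflexive (trans (cong (λ t → x + + 2 * t) (ℤₚ.+-inverseʳ x)) (ℤₚ.+-identityʳ x))))

  -- Value tables and completeness of the search

  rep : ∀ n .{{_ : ℕ.NonZero n}} → ℤ → ℕ
  rep n z = toℕ (residue n z)

  module _ (n : ℕ) .{{_ : ℕ.NonZero n}} where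

    ℕ-gap : ∀ {a b} → a ℕ.≤ b → + b ≡ + a [ n ] → b ℕ.< n → b ℕ.≤ a
    ℕ-gap {a} {b} a≤b e b<n = ℕₚ.m∸n≡0⇒m≤n (∣<⇒zero
      (ℕ-≡⇒∣ a (b ℕ.∸ a) (subst (λ c → + c ≡ + a [ n ]) (sym (ℕₚ.m+[n∸m]≡n a≤b)) e))
      (ℕₚ.≤-<-trans (ℕₚ.m∸n≤m b a) b<n))

    ℕ-unique : ∀ {a b} → + a ≡ + b [ n ] → a ℕ.< n → b ℕ.< n → a ≡ b
    ℕ-unique {a} {b} e a<n b<n with ℕₚ.≤-total a b
    ... | inj₁ a≤b = ℕₚ.≤-antisym a≤b (ℕ-gap a≤b (mod-sym e) b<n)
    ... | inj₂ b≤a = ℕₚ.≤-antisym (ℕ-gap b≤a e a<n) b≤a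

    rep< : ∀ z → rep n z ℕ.< n
    rep< z = Finₚ.toℕ<n (residue n z)

    rep-unique : ∀ {z a} → z ≡ + a [ n ] → a ℕ.< n → rep n z ≡ a
    rep-unique {z} e a<n = ℕ-unique (mod-trans (mod-sym (residue-≡ n z)) e) (rep< z) a<n

    rep-cong : x ≡ y [ n ] → rep n x ≡ rep n y
    rep-cong {x} {y} e = rep-unique (mod-trans e (residue-≡ n y)) (rep< y)

    rep-inj : rep n x ≡ rep n y → x ≡ y [ n ]
    rep-inj {x} {y} e = mod-trans (residue-≡ n x) (mod-trans (mod-reflexive (cong +_ e)) (mod-sym (residue-≡ n y)))

    %-≡ : ∀ a → + (a ℕ.% n) ≡ + a [ n ]
    %-≡ a = mod-sym (by (+ (a ℕ./ n)) (trans (cong +_ (ℕ/.m≡m%n+[m/n]*n a n))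
      (trans (pos-+ (a ℕ.% n) _) (cong (λ t → + (a ℕ.% n) + t) (pos-* (a ℕ./ n) n)))))

    rep-+ : ∀ x y → (rep n x ℕ.+ rep n y) ℕ.% n ≡ rep n (x + y)
    rep-+ x y = sym (rep-unique (mod-sym (mod-trans (%-≡ _) (mod-trans (mod-reflexive (pos-+ (rep n x) (rep n y)))
      (mod-sym (mod-+ (residue-≡ n x) (residue-≡ n y)))))) (ℕ/.m%n<n _ n))

    table : (ℤ → ℤ) → List ℕ
    table f = applyUpTo (λ i → rep n (f (+ i))) n

  at-applyUpTo : ∀ (g : ℕ → ℕ) {m i} → i ℕ.< m → at (applyUpTo g m) i ≡ g i
  at-applyUpTo g {suc m} {zero}  _         = refl
  at-applyUpTo g {suc m} {suc i} (s≤s i<m) = at-applyUpTo (g ∘ suc) i<m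

  applyUpTo-+ : ∀ (g : ℕ → ℕ) m l → applyUpTo g (m ℕ.+ l) ≡ applyUpTo g m ++ applyUpTo (g ∘ (m ℕ.+_)) l
  applyUpTo-+ g zero    l = refl
  applyUpTo-+ g (suc m) l = cong (g 0 ∷_) (applyUpTo-+ (g ∘ suc) m l)

  applyUpTo-cong : ∀ {g h : ℕ → ℕ} → (∀ i → g i ≡ h i) → ∀ m → applyUpTo g m ≡ applyUpTo h m
  applyUpTo-cong e zero    = refl
  applyUpTo-cong e (suc m) = cong₂ _∷_ (e 0) (applyUpTo-cong (e ∘ suc) m)

  ∈-choices : ∀ n (g h : ℕ → ℕ) → (∀ i → h i ≡ g i ⊎ h i ≡ g i ℕ.+ n) →
    ∀ m → applyUpTo h m ∈ choices n (applyUpTo g m)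
  ∈-choices n g h e zero    = here refl
  ∈-choices n g h e (suc m) = ∈-concatMap⁺ _ (Any.map extend (∈-choices n (g ∘ suc) (h ∘ suc) (e ∘ suc) m))
    where
    extend : ∀ {ys} → applyUpTo (h ∘ suc) m ≡ ys →
      (h 0 ∷ applyUpTo (h ∘ suc) m) ∈ (g 0 ∷ ys) ∷ (g 0 ℕ.+ n ∷ ys) ∷ []
    extend refl with e 0
    ... | inj₁ h≡g  = here (cong (_∷ applyUpTo (h ∘ suc) m) h≡g)
    ... | inj₂ h≡g+ = there (here (cong (_∷ applyUpTo (h ∘ suc) m) h≡g+))

  module _ {f : ℤ → ℤ} {π : ℤ → ℕ} {M′ n : ℕ} .{{_ : ℕ.NonZero n}} (S : Skew f π M′ n) where
    open Skew S
    open SkewProperties S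

    private
      t : List ℕ
      t = table n f

    at-table : ∀ z → at t (rep n z) ≡ rep n (f z)
    at-table z = trans (at-applyUpTo _ (rep< n z)) (rep-cong n (cong-mod (mod-sym (residue-≡ n z))))

    iter-table : ∀ i z → iter (at t) i (rep n z) ≡ rep n (iter f i z)
    iter-table zero    z = refl
    iter-table (suc i) z = trans (cong (at t) (iter-table i z)) (at-table (iter f i z))

    rep-small : ∀ {a} → a ℕ.< n → rep n (+ a) ≡ a
    rep-small a<n = rep-unique n mod-refl a<n

    skew-table : ∀ k .{{_ : ℕ.NonZero k}} → Fixes f n k → SkewTable n k t
    skew-table k fixes = Allₚ.applyUpTo⁺₁ (λ a → a) n λ {a} a<n →
      Anyₚ.applyUpTo⁺ (λ i → i) {i = π (+ a) ℕ.% k} (Allₚ.applyUpTo⁺₁ (λ b → b) n λ {b} b<n →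
        subst₂ (λ a′ b′ → at t ((a′ ℕ.+ b′) ℕ.% n) ≡ (at t a′ ℕ.+ iter (at t) (π (+ a) ℕ.% k) b′) ℕ.% n)
          (rep-small a<n) (rep-small b<n) (step (+ a) (+ b)))
        (ℕ/.m%n<n (π (+ a)) k)
      where
      open ≡-Reasoning
      step : ∀ a b → at t ((rep n a ℕ.+ rep n b) ℕ.% n) ≡
        (at t (rep n a) ℕ.+ iter (at t) (π a ℕ.% k) (rep n b)) ℕ.% n
      step a b = begin
        at t ((rep n a ℕ.+ rep n b) ℕ.% n)                       ≡⟨ cong (at t) (rep-+ n a b) ⟩
        at t (rep n (a + b))                                     ≡⟨ at-table (a + b) ⟩
        rep n (f (a + b))  ≡⟨ rep-cong n (mod-trans (skew a b) (mod-+ˡ (f a) (iter-% fixes (π a) b))) ⟩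
        rep n (f a + iter f (π a ℕ.% k) b)                       ≡⟨ rep-+ n (f a) _ ⟨
        (rep n (f a) ℕ.+ rep n (iter f (π a ℕ.% k) b)) ℕ.% n
          ≡⟨ cong₂ (λ u v → (u ℕ.+ v) ℕ.% n) (at-table a) (iter-table (π a ℕ.% k) b) ⟨
        (at t (rep n a) ℕ.+ iter (at t) (π a ℕ.% k) (rep n b)) ℕ.% n  ∎

    coset-from-table : CosetTable n t → ∀ x y → f (f x + y) + f x ≡ f (x + y) + f (f x) [ n ]
    coset-from-table ct x y = rep-inj n (begin
      rep n (f (f x + y) + f x)                                            ≡⟨ rep-+ n _ _ ⟨
      (rep n (f (f x + y)) ℕ.+ rep n (f x)) ℕ.% n  ≡⟨ cong (λ u → (u ℕ.+ rep n (f x)) ℕ.% n) (at-table (f x + y)) ⟨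
      (at t (rep n (f x + y)) ℕ.+ rep n (f x)) ℕ.% n  ≡⟨ cong (λ u → (at t u ℕ.+ rep n (f x)) ℕ.% n) (rep-+ n (f x) y) ⟨
      (at t ((rep n (f x) ℕ.+ rep n y) ℕ.% n) ℕ.+ rep n (f x)) ℕ.% n
        ≡⟨ cong (λ u → (at t ((u ℕ.+ rep n y) ℕ.% n) ℕ.+ u) ℕ.% n) (at-table x) ⟨
      (at t ((at t a ℕ.+ b) ℕ.% n) ℕ.+ at t a) ℕ.% n
        ≡⟨ Allₚ.applyUpTo⁻ (λ b → b) n (Allₚ.applyUpTo⁻ (λ a → a) n ct (rep< n x)) (rep< n y) ⟩
      (at t ((a ℕ.+ b) ℕ.% n) ℕ.+ at t (at t a)) ℕ.% n  ≡⟨ cong₂ (λ u v → (at t u ℕ.+ at t v) ℕ.% n) (rep-+ n x y) (at-table x) ⟩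
      (at t (rep n (x + y)) ℕ.+ at t (rep n (f x))) ℕ.% n
        ≡⟨ cong₂ (λ u v → (u ℕ.+ v) ℕ.% n) (at-table (x + y)) (at-table (f x)) ⟩
      (rep n (f (x + y)) ℕ.+ rep n (f (f x))) ℕ.% n                        ≡⟨ rep-+ n _ _ ⟩
      rep n (f (x + y) + f (f x))                                          ∎)
      where
      open ≡-Reasoning
      a b : ℕ
      a = rep n x
      b = rep n y

  module _ {f : ℤ → ℤ} {π : ℤ → ℕ} {M′ n : ℕ} .{{_ : ℕ.NonZero n}} .{{_ : ℕ.NonZero (n ℕ.+ n)}} (S : Skew f π M′ (n ℕ.+ n))
    (shift : ∀ y → f (y + + n) ≡ f y + + n [ n ℕ.+ n ]) where

    private
      2n = n ℕ.+ n

      halve : x ≡ y [ 2n ] → x ≡ y [ n ]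
      halve {x} {y} e = mod-coarsen 2 (subst (λ k → x ≡ y [ n ℕ.+ k ]) (sym (ℕₚ.+-identityʳ n)) e)

      half : ∀ z → rep 2n z ≡ rep n z ⊎ rep 2n z ≡ rep n z ℕ.+ n
      half z with rep 2n z ℕₚ.<? n
      ... | yes r<n = inj₁ (sym (rep-unique n (halve (residue-≡ 2n z)) r<n))
      ... | no  r≮n = inj₂ (trans (sym (ℕₚ.m∸n+n≡m n≤r)) (cong (ℕ._+ n) (sym (rep-unique n
            (mod-trans (halve (residue-≡ 2n z)) (by 1ℤ (trans (cong +_ (sym (ℕₚ.m∸n+n≡m n≤r)))
              (trans (pos-+ (rep 2n z ℕ.∸ n) n) (cong (λ t → + (rep 2n z ℕ.∸ n) + t) (sym (ℤₚ.*-identityˡ (+ n))))))))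
            (ℕₚ.+-cancelʳ-< n _ n (subst (ℕ._< 2n) (sym (ℕₚ.m∸n+n≡m n≤r)) (rep< 2n z)))))))
        where
        n≤r : n ℕ.≤ rep 2n z
        n≤r = ℕₚ.≮⇒≥ r≮n

      upper : ∀ i → rep 2n (f (+ (n ℕ.+ i))) ≡ (rep 2n (f (+ i)) ℕ.+ n) ℕ.% 2n
      upper i = rep-unique 2n (begin
        f (+ (n ℕ.+ i))                        ≡⟨ cong (f ∘ +_) (ℕₚ.+-comm n i) ⟩
        f (+ (i ℕ.+ n))                        ≡⟨ cong f (pos-+ i n) ⟩
        f (+ i + + n)                          ≈⟨ shift (+ i) ⟩
        f (+ i) + + n                          ≈⟨ mod-+ʳ (+ n) (residue-≡ 2n (f (+ i))) ⟩
        + rep 2n (f (+ i)) + + n               ≡⟨ pos-+ (rep 2n (f (+ i))) n ⟨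
        + (rep 2n (f (+ i)) ℕ.+ n)             ≈⟨ %-≡ 2n _ ⟨
        + ((rep 2n (f (+ i)) ℕ.+ n) ℕ.% 2n)    ∎) (ℕ/.m%n<n _ 2n)
        where open Mod 2n

      table-double : table 2n f ≡ double n (applyUpTo (λ i → rep 2n (f (+ i))) n)
      table-double = trans (applyUpTo-+ (λ i → rep 2n (f (+ i))) n n)
        (cong (applyUpTo (λ i → rep 2n (f (+ i))) n ++_)
          (trans (applyUpTo-cong upper n) (sym (Listₚ.map-applyUpTo _ _ n))))

    -- Completeness of one doubling step: each value mod 2n is its value mod n or that plus n, the
    -- upper half follows from `shift`, and the filter keeps the table because it comes from a skew
    -- morphism.
    table-lift : ∀ k .{{_ : ℕ.NonZero k}} → Fixes f 2n k → ∀ {ts} → table n f ∈ ts → table 2n f ∈ lifts n k ts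
    table-lift k fixes t∈ts = ∈-filter⁺ (skewTable? 2n k)
      (∈-concatMap⁺ _ (lose t∈ts (subst (_∈ map (double n) (choices n (table n f))) (sym table-double)
        (∈-map⁺ (double n) (∈-choices n _ _ (λ i → half (f (+ i))) n)))))
      (skew-table S k fixes)

  module _ {f : ℤ → ℤ} {π : ℤ → ℕ} {M′ : ℕ} (S₁₆ : Skew f π M′ 16) where

    private
      S₈ : Skew f π M′ 8
      S₈ = proj₁ (two-power-quotient 3 S₁₆)
      S₄ : Skew f π M′ 4
      S₄ = proj₁ (two-power-quotient 2 S₈)
      S₂ : Skew f π M′ 2
      S₂ = proj₁ (two-power-quotient 1 S₄)

      shift : ∀ {n d} → Fibre f n d 1ℤ → ∀ y → f (y + + d) ≡ f y + + d [ n ℕ.* d ]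
      shift {n} {d} fib y = subst (λ t → f (y + t) ≡ f y + t [ n ℕ.* d ]) (ℤₚ.*-identityˡ (+ d)) (fib y 1ℤ)

      fixes₂ : Fixes f 2 1
      -- For `d = 1` the whole of ℤ/2 is one fibre, so `f` is affine of slope 1 and fixes 0.
      fixes₂ x = begin
        f x                     ≡⟨ cong f (lemma₁ x) ⟩
        f (0ℤ + x * + 1)        ≈⟨ proj₂ (two-power-quotient 0 S₂) 0ℤ x ⟩
        f 0ℤ + 1ℤ * x * + 1     ≈⟨ mod-+ʳ (1ℤ * x * + 1) (Skew.zero-mod S₂) ⟩
        0ℤ + 1ℤ * x * + 1       ≡⟨ lemma₂ x ⟩
        x                       ∎
        where
        open Mod 2
        lemma₁ : ∀ x → x ≡ 0ℤ + x * 1ℤ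
        lemma₁ = solve-∀
        lemma₂ : ∀ x → 0ℤ + 1ℤ * x * 1ℤ ≡ x
        lemma₂ = solve-∀

      fixes₄ : Fixes f 4 2
      fixes₄ = fixes-double S₄ (proj₂ (two-power-quotient 1 S₄)) 1 fixes₂

      fixes₈ : Fixes f 8 4
      fixes₈ = fixes-double S₈ (proj₂ (two-power-quotient 2 S₈)) 2 fixes₄

    fixes₁₆ : Fixes f 16 8
    fixes₁₆ = fixes-double S₁₆ (proj₂ (two-power-quotient 3 S₁₆)) 4 fixes₈

    private
      table₂ : table 2 f ∈ (0 ∷ 1 ∷ []) ∷ []
      table₂ = here (cong₂ (λ a b → a ∷ b ∷ []) (rep-unique 2 (fixes₂ 0ℤ) (s≤s z≤n)) (rep-unique 2 (fixes₂ 1ℤ) (s≤s (s≤s z≤n))))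

      table₁₆ : table 16 f ∈ tables₁₆
      table₁₆ = table-lift S₁₆ (shift {2} {8} (proj₂ (two-power-quotient 3 S₁₆))) 8 fixes₁₆
        (table-lift S₈ (shift {2} {4} (proj₂ (two-power-quotient 2 S₈))) 4 fixes₈
        (table-lift S₄ (shift {2} {2} (proj₂ (two-power-quotient 1 S₄))) 2 fixes₄ table₂))

    coset-preserving₁₆ : ∀ x y → f (f x + y) + f x ≡ f (x + y) + f (f x) [ 16 ]
    coset-preserving₁₆ = coset-from-table S₁₆ (All.lookup coset₁₆ table₁₆)

  -- Skew morphisms of ℤ/16p

  mod-^ : ∀ k → x ≡ y [ n ] → x ^ k ≡ y ^ k [ n ]
  mod-^ zero    e = mod-refl
  mod-^ (suc k) e = mod-* e (mod-^ k e)

  pos-^ : ∀ a k → + (a ℕ.^ k) ≡ (+ a) ^ k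
  pos-^ a zero    = refl
  pos-^ a (suc k) = trans (pos-* a (a ℕ.^ k)) (cong (λ t → + a * t) (pos-^ a k))

  opaque
    total : ℕ → (ℤ → ℤ) → ℤ
    total n g = Sum.sum {n} (λ i → g (+ toℕ i))

    total-cong : ∀ m {g h} → (∀ x → g x ≡ h x [ n ]) → total m g ≡ total m h [ n ]
    total-cong {n} m {g} {h} e = sum-cong {m} {λ i → g (+ toℕ i)} {λ i → h (+ toℕ i)} λ i → e (+ toℕ i)
      where
      sum-cong : ∀ {m} {u v : Fin m → ℤ} → (∀ i → u i ≡ v i [ n ]) → Sum.sum u ≡ Sum.sum v [ n ]
      sum-cong {zero}  e = mod-refl
      sum-cong {suc m} e = mod-+ (e Fin.zero) (sum-cong (e ∘ Fin.suc))

    total-+ : ∀ m g h → total m (λ x → g x + h x) ≡ total m g + total m h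
    total-+ m g h = Sum.∑-distrib-+ {m} (λ i → g (+ toℕ i)) (λ i → h (+ toℕ i))

    total-* : ∀ m c g → total m (λ x → c * g x) ≡ c * total m g
    total-* m c g = sym (Sum.*-distribˡ-sum {m} c (λ i → g (+ toℕ i)))

    total-const : ∀ m c → total m (λ _ → c) ≡ + m * c
    total-const zero    c = refl
    total-const (suc m) c = trans (cong (λ t → c + t) (total-const m c))
      (trans (lemma (+ m) c) (cong (λ t → t * c) (sym (pos-+ 1 m))))
      where
      lemma : ∀ m c → c + m * c ≡ (1ℤ + m) * c
      lemma = solve-∀

    total-permute : ∀ m .{{_ : ℕ.NonZero m}} g (α β : ℤ → ℤ) →
      (∀ {x y} → x ≡ y [ m ] → g x ≡ g y [ n ]) →
      (∀ {x y} → x ≡ y [ m ] → α x ≡ α y [ m ]) → (∀ {x y} → x ≡ y [ m ] → β x ≡ β y [ m ]) →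
      (∀ x → α (β x) ≡ x [ m ]) → (∀ x → β (α x) ≡ x [ m ]) →
      total m g ≡ total m (g ∘ α) [ n ]
    total-permute {n} m g α β g-cong α-cong β-cong αβ βα = mod-trans
      (mod-reflexive (Sum.sum-permute {m} {m} (λ i → g (+ toℕ i)) ρ))
      (total-cong m {g ∘ λ x → + toℕ (residue m (α x))} {g ∘ α} (λ x → g-cong (mod-sym (residue-≡ m (α x)))))
      where
      residue-unique : ∀ {z} (i : Fin m) → z ≡ + toℕ i [ m ] → residue m z ≡ i
      residue-unique {z} i e = Finₚ.toℕ-injective (ℕ-unique m (mod-trans (mod-sym (residue-≡ m z)) e)
        (Finₚ.toℕ<n (residue m z)) (Finₚ.toℕ<n i))
      lift : (ℤ → ℤ) → Fin m → Fin m
      lift α i = residue m (α (+ toℕ i))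
      inverse : ∀ {α β} → (∀ {x y} → x ≡ y [ m ] → α x ≡ α y [ m ]) → (∀ x → α (β x) ≡ x [ m ]) →
        ∀ i → lift α (lift β i) ≡ i
      inverse α-cong αβ i = residue-unique i (mod-trans (α-cong (mod-sym (residue-≡ m _))) (αβ (+ toℕ i)))
      ρ : Permutation′ m
      ρ = permutation (lift α) (lift β) (inverse α-cong αβ) (inverse β-cong βα)

  -- Pigeonhole on 0 and the p powers with exponents 0 to `p − 1`, none of which is zero. The bound
  -- `k < p` is essential later: it makes the exponent prime to p.
  unit-power : ∀ {p} → Prime p → ∀ a → ¬ a ≡ 0ℤ [ p ] → ∃ λ k → 1 ℕ.≤ k × k ℕ.< p × a ^ k ≡ 1ℤ [ p ]
  unit-power {p} pp a a≢0 = from-collision (Finₚ.pigeonhole (ℕₚ.n<1+n p) point)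
    where
    instance
      _ : ℕ.NonZero p
      _ = prime⇒nonZero pp
    point : Fin (suc p) → Fin p
    point Fin.zero    = residue p 0ℤ
    point (Fin.suc i) = residue p (a ^ toℕ i)
    same-residue : ∀ x y → residue p x ≡ residue p y → x ≡ y [ p ]
    same-residue x y e = mod-trans (residue-≡ p x) (mod-trans (mod-reflexive (cong (+_ ∘ toℕ) e)) (mod-sym (residue-≡ p y)))
    power≢0 : ∀ i → ¬ a ^ i ≡ 0ℤ [ p ]
    power≢0 zero    e = contradiction (m⇒∣ e) (ℕ∣.>⇒∤ (ℕ.nonTrivial⇒n>1 p {{prime⇒nonTrivial pp}}))
    power≢0 (suc i) e with zero-product pp {a} {a ^ i} e
    ... | inj₁ a≡0  = a≢0 a≡0
    ... | inj₂ aⁱ≡0 = power≢0 i aⁱ≡0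
    from-collision : (∃₂ λ i j → i Fin.< j × point i ≡ point j) → ∃ λ k → 1 ℕ.≤ k × k ℕ.< p × a ^ k ≡ 1ℤ [ p ]
    from-collision (Fin.zero , Fin.suc j , _ , e) =
      contradiction (mod-sym (same-residue 0ℤ (a ^ toℕ j) e)) (power≢0 (toℕ j))
    from-collision (Fin.suc i , Fin.suc j , s≤s i<j , e) = toℕ j ℕ.∸ toℕ i , ℕₚ.m<n⇒0<n∸m i<j
      , ℕₚ.≤-<-trans (ℕₚ.m∸n≤m (toℕ j) (toℕ i)) (Finₚ.toℕ<n j)
      , mod-*-cancelˡ pp (a ^ toℕ i) (power≢0 (toℕ i)) (begin
          a ^ toℕ i * a ^ (toℕ j ℕ.∸ toℕ i)     ≡⟨ ℤₚ.^-distribˡ-+-* a (toℕ i) _ ⟨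
          a ^ (toℕ i ℕ.+ (toℕ j ℕ.∸ toℕ i))     ≡⟨ cong (a ^_) (ℕₚ.m+[n∸m]≡n (ℕₚ.<⇒≤ i<j)) ⟩
          a ^ toℕ j                             ≈⟨ same-residue (a ^ toℕ i) (a ^ toℕ j) e ⟨
          a ^ toℕ i                             ≡⟨ ℤₚ.*-identityʳ (a ^ toℕ i) ⟨
          a ^ toℕ i * 1ℤ                        ∎)
      where open Mod p

  -- If `r^o = 1` with `o < p`, then `8 o` is a unit mod p and some power `(8 o)^k` is 1 mod p. That
  -- power is still divisible by 8 and by o; it is written as `l · 8`.
  common-exponent : ∀ {p} → Prime p → p ≢ 2 → ∀ r → ¬ r ≡ 0ℤ [ p ] →
    ∃ λ l → + (l ℕ.* 8) ≡ 1ℤ [ p ] × r ^ (l ℕ.* 8) ≡ 1ℤ [ p ]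
  common-exponent {p} pp p≢2 r r≢0 =
    let o , 1≤o , o<p , rᵒ≡1 = unit-power pp r r≢0
        k , 1≤k , _ , cᵏ≡1 = unit-power pp (+ (8 ℕ.* o)) (c≢0 o 1≤o o<p)
        k≡ = ℕₚ.m+[n∸m]≡n 1≤k
        l = o ℕ.* (8 ℕ.* o) ℕ.^ (k ℕ.∸ 1)
    in l , mod-trans (mod-reflexive (trans (cong +_ (trans (exponent o (k ℕ.∸ 1)) (cong ((8 ℕ.* o) ℕ.^_) k≡))) (pos-^ (8 ℕ.* o) k))) cᵏ≡1
     , r-power o ((8 ℕ.* o) ℕ.^ (k ℕ.∸ 1)) rᵒ≡1
    where
    c≢0 : ∀ o → 1 ℕ.≤ o → o ℕ.< p → ¬ + (8 ℕ.* o) ≡ 0ℤ [ p ]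
    c≢0 o 1≤o o<p e with zero-product pp {+ 8} {+ o} (mod-trans (mod-reflexive (sym (pos-* 8 o))) e)
    ... | inj₂ o≡0 = contradiction (subst (p ℕ∣.∣_) (ℕₚ.+-identityʳ o) (m⇒∣ o≡0)) (ℕ∣.>⇒∤ {{ℕ.>-nonZero 1≤o}} o<p)
    ... | inj₁ 8≡0 with prime∣2^k*p 2 pp prime[2] (m⇒∣ 8≡0)
    ...   | inj₁ (p≡2 , _) = p≢2 p≡2
    ...   | inj₂ p≡2       = p≢2 p≡2
    exponent : ∀ o k → o ℕ.* (8 ℕ.* o) ℕ.^ k ℕ.* 8 ≡ (8 ℕ.* o) ℕ.^ suc k
    exponent o k = trans (ℕₚ.*-comm (o ℕ.* (8 ℕ.* o) ℕ.^ k) 8) (sym (ℕₚ.*-assoc 8 o _))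
    r-power : ∀ o c → r ^ o ≡ 1ℤ [ p ] → r ^ (o ℕ.* c ℕ.* 8) ≡ 1ℤ [ p ]
    r-power o c e = mod-trans (mod-reflexive (trans (cong (r ^_) (ℕₚ.*-assoc o c 8)) (sym (ℤₚ.^-*-assoc r o (c ℕ.* 8)))))
      (mod-trans (mod-^ (c ℕ.* 8) e) (mod-reflexive (ℤₚ.^-zeroˡ (c ℕ.* 8))))

  -- For fixed T the displacement F x = f^T x − x lies in 16ℤ/16p, and f^D x − x = D F x mod p
  -- for every exponent D acting trivially on ℤ/16 and on 16ℤ/16p.
  module Displacement {f : ℤ → ℤ} {π : ℤ → ℕ} {M′ p : ℕ} {r : ℤ} (pp : Prime p) (p≢2 : p ≢ 2) (S : Skew f π M′ (p ℕ.* 16))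
    (S₁₆ : Skew f π M′ 16) (fib : Fibre f p 16 r) (r≢0 : ¬ r ≡ 0ℤ [ p ])
    (fixes₁₆ : Fixes f 16 8)
    (T : ℕ) (T-fixes : Fixes f 16 T) (T≡1 : + T ≡ 1ℤ [ p ]) (rᵀ≡1 : r ^ T ≡ 1ℤ [ p ]) where

    open Skew S
    open SkewProperties S
    private module S₁₆ = SkewProperties S₁₆
    open FibreProperties {q = p} {16} {r} S fib using (iter-shift; iter-power)

    private
      N : ℕ
      N = p ℕ.* 16

    to-p : x ≡ y [ N ] → x ≡ y [ p ]
    to-p {x} {y} e = mod-coarsen 16 (subst (λ n → x ≡ y [ n ]) (ℕₚ.*-comm p 16) e)

    to-16 : x ≡ y [ N ] → x ≡ y [ 16 ]
    to-16 = mod-coarsen p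

    sixteen≢0 : ¬ + 16 ≡ 0ℤ [ p ]
    sixteen≢0 e with prime∣2^k*p 3 pp prime[2] (m⇒∣ e)
    ... | inj₁ (p≡2 , _) = p≢2 p≡2
    ... | inj₂ p≡2       = p≢2 p≡2

    crt : x ≡ y [ 16 ] → x ≡ y [ p ] → x ≡ y [ N ]
    crt {x} {y} (by k eq) e = mod-trans (mod-reflexive eq) (mod-trans (mod-+ˡ y (mod-scaleʳ 16 k≡0)) (mod-reflexive (ℤₚ.+-identityʳ y)))
      where
      k≡0 : k ≡ 0ℤ [ p ]
      k≡0 = zero-factorˡ pp {+ 16} {k} sixteen≢0 (mod-cancelˡ y (mod-trans (mod-reflexive (sym eq))
        (mod-trans e (mod-reflexive (sym (ℤₚ.+-identityʳ y))))))

    power-of-multiplier : ∀ D c → iter f D (+ 16) ≡ c * + 16 [ N ] → r ^ D ≡ c [ p ]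
    power-of-multiplier D c e = mod-unscaleʳ 16 (begin
      r ^ D * + 16                        ≡⟨ lemma (r ^ D) (+ 16) ⟩
      0ℤ + r ^ D * 1ℤ * + 16              ≈⟨ mod-+ʳ (r ^ D * 1ℤ * + 16) (iter-zero D) ⟨
      iter f D 0ℤ + r ^ D * 1ℤ * + 16     ≈⟨ iter-shift D 0ℤ 1ℤ ⟨
      iter f D (+ 16)                     ≈⟨ e ⟩
      c * + 16                            ∎)
      where
      open Mod N
      lemma : ∀ a s → a * s ≡ 0ℤ + a * 1ℤ * s
      lemma = solve-∀

    -- Expanding `f (x + 16)` by `skew` and by `fib` shows that `f^(π x)` acts on P as `f` does.
    multiplier-π : ∀ x → r ^ π x ≡ r [ p ]
    multiplier-π x = power-of-multiplier (π x) r (mod-cancelˡ (f x) (begin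
      f x + iter f (π x) (+ 16)    ≈⟨ skew x (+ 16) ⟨
      f (x + 1ℤ * + 16)            ≈⟨ fib x 1ℤ ⟩
      f x + r * 1ℤ * + 16          ≡⟨ cong (λ t → f x + t * + 16) (ℤₚ.*-identityʳ r) ⟩
      f x + r * + 16               ∎))
      where open Mod N

    -- The values are multiples of 16, and 16 is invertible mod p, so reading `F` mod p loses
    -- nothing. By `F-cong` it is then a function from ℤ/16 to 𝔽ₚ.
    F : ℤ → ℤ
    F x = iter f T x - x

    F≡0₁₆ : ∀ x → F x ≡ 0ℤ [ 16 ]
    F≡0₁₆ x = mod-trans (mod-+ʳ (- x) (T-fixes x)) (mod-reflexive (ℤₚ.+-inverseʳ x))

    iter-T : ∀ x → iter f T x ≡ x + F x
    iter-T x = lemma (iter f T x) x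
      where
      lemma : ∀ a x → a ≡ x + (a - x)
      lemma = solve-∀

    F-zero : F 0ℤ ≡ 0ℤ [ p ]
    F-zero = mod-trans (mod-+ʳ (- 0ℤ) (to-p (iter-zero T))) (mod-reflexive refl)

    F-cong : x ≡ y [ 16 ] → F x ≡ F y [ p ]
    F-cong {x} {y} (by k refl) = to-p (begin
      iter f T (y + k * + 16) - (y + k * + 16)            ≈⟨ mod-+ʳ (- (y + k * + 16)) (iter-shift T y k) ⟩
      iter f T y + r ^ T * k * + 16 - (y + k * + 16)
        ≈⟨ mod-+ʳ (- (y + k * + 16)) (mod-+ˡ (iter f T y) (mod-scaleʳ 16 (mod-*ʳ k rᵀ≡1))) ⟩
      iter f T y + 1ℤ * k * + 16 - (y + k * + 16)         ≡⟨ lemma (iter f T y) y k (+ 16) ⟩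
      iter f T y - y                                      ∎)
      where
      open Mod N
      lemma : ∀ a y k s → a + 1ℤ * k * s - (y + k * s) ≡ a - y
      lemma = solve-∀

    -- `f^(T D) x − x` equals both T times the displacement by `f^D` and D times the displacement by
    -- `f^T`; now `T ≡ 1`.
    displacement : ∀ D → Fixes f 16 D → r ^ D ≡ 1ℤ [ p ] → ∀ x → iter f D x - x ≡ + D * F x [ p ]
    displacement D D-fixes rᴰ≡1 x = begin
      iter f D x - x                ≡⟨ ℤₚ.*-identityˡ (iter f D x - x) ⟨
      1ℤ * (iter f D x - x)         ≈⟨ mod-*ʳ (iter f D x - x) T≡1 ⟨
      + T * (iter f D x - x)        ≈⟨ mod-cancelˡ x (to-p (mod-trans (mod-sym (iter-power D D-fixes rᴰ≡1 T x))
                                         (mod-trans (mod-reflexive (cong (λ k → iter f k x) (ℕₚ.*-comm T D)))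
                                           (iter-power T T-fixes rᵀ≡1 D x)))) ⟩
      + D * F x                     ∎
      where open Mod p

    fixes-from-displacement : ∀ D → Fixes f 16 D → r ^ D ≡ 1ℤ [ p ] → (∀ x → + D * F x ≡ 0ℤ [ p ]) → Fixes f N D
    fixes-from-displacement D D-fixes rᴰ≡1 e x = crt (D-fixes x) (begin
      iter f D x            ≡⟨ lemma (iter f D x) x ⟩
      x + (iter f D x - x)  ≈⟨ mod-+ˡ x (mod-trans (displacement D D-fixes rᴰ≡1 x) (e x)) ⟩
      x + 0ℤ                ≡⟨ ℤₚ.+-identityʳ x ⟩
      x                     ∎)
      where
      open Mod p
      lemma : ∀ a x → a ≡ x + (a - x)
      lemma = solve-∀

    s : ℤ → ℤ
    s x = + σ f π x T

    -- The exponent `σ f π x T` inherits from T its trivial action on ℤ/16 and on P, so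
    -- `displacement` turns that power into a multiple of `F y`.
    F-+ : ∀ x y → F (x + y) ≡ F x + s x * F y [ p ]
    F-+ x y = begin
      iter f T (x + y) - (x + y)                     ≈⟨ mod-+ʳ (- (x + y)) (to-p (iter-skew T x y)) ⟩
      iter f T x + iter f D y - (x + y)              ≡⟨ lemma (iter f T x) (iter f D y) x y ⟩
      F x + (iter f D y - y)                         ≈⟨ mod-+ˡ (F x) (displacement D D-fixes rᴰ≡1 y) ⟩
      F x + s x * F y                                ∎
      where
      open Mod p
      D : ℕ
      D = σ f π x T
      D-fixes : Fixes f 16 D
      D-fixes y = mod-cancelˡ x (mod-trans (mod-sym (mod-+ʳ (iter f D y) (T-fixes x)))
        (mod-trans (mod-sym (S₁₆.iter-skew T x y)) (T-fixes (x + y))))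
      rᴰ≡1 : r ^ D ≡ 1ℤ [ p ]
      rᴰ≡1 = power-of-multiplier D 1ℤ (mod-cancelˡ (iter f T x) (mod-trans (mod-sym (iter-skew T x (+ 16)))
        (mod-trans (iter-shift T x 1ℤ) (mod-+ˡ (iter f T x) (mod-scaleʳ 16 (mod-*ʳ 1ℤ rᵀ≡1))))))
      lemma : ∀ a b x y → a + b - (x + y) ≡ a - x + (b - y)
      lemma = solve-∀

    F-f : ∀ x → F (f x) ≡ r * F x [ p ]
    F-f x with F≡0₁₆ x
    ... | by δ eq = to-p (begin
      iter f T (f x) - f x            ≡⟨ cong (λ t → t - f x) (iter-swap f T 1 x) ⟩
      f (iter f T x) - f x            ≡⟨ cong (λ t → f t - f x) (trans (iter-T x) (cong (λ t → x + t) Fx≡)) ⟩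
      f (x + δ * + 16) - f x          ≈⟨ mod-+ʳ (- f x) (fib x δ) ⟩
      f x + r * δ * + 16 - f x        ≡⟨ lemma (f x) r δ (+ 16) ⟩
      r * (δ * + 16)                  ≡⟨ cong (λ t → r * t) Fx≡ ⟨
      r * F x                         ∎)
      where
      open Mod N
      Fx≡ : F x ≡ δ * + 16
      Fx≡ = trans eq (ℤₚ.+-identityˡ (δ * + 16))
      lemma : ∀ a r δ s → a + r * δ * s - a ≡ r * (δ * s)
      lemma = solve-∀

    F-iter : ∀ k x → F (iter f k x) ≡ r ^ k * F x [ p ]
    F-iter zero    x = mod-reflexive (sym (ℤₚ.*-identityˡ (F x)))
    F-iter (suc k) x = mod-trans (F-f (iter f k x)) (mod-trans (mod-*ˡ r (F-iter k x)) (mod-reflexive (sym (ℤₚ.*-assoc r (r ^ k) (F x)))))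

    h : ℤ → ℤ
    h x = f x - x

    -- The displacement `f^k y − y` telescoped along the orbit, so that each term can be summed over
    -- ℤ/16 separately.
    H : ℕ → ℤ → ℤ
    H zero    y = 0ℤ
    H (suc k) y = h (iter f k y) + H k y

    iter-H : ∀ k y → iter f k y ≡ y + H k y
    iter-H zero    y = sym (ℤₚ.+-identityʳ y)
    iter-H (suc k) y = trans (lemma (f (iter f k y)) (iter f k y) (H k y)) (cong (λ t → t + H (suc k) y) (trans (cong (λ t → t - H k y) (iter-H k y)) (lemma′ y (H k y))))
      where
      lemma : ∀ a b t → a ≡ b - t + (a - b + t)
      lemma = solve-∀
      lemma′ : ∀ y t → y + t - t ≡ y
      lemma′ = solve-∀

    h-+ : ∀ x y → h (x + y) ≡ h x + H (π x) y [ p ]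
    h-+ x y = begin
      f (x + y) - (x + y)                     ≈⟨ mod-+ʳ (- (x + y)) (to-p (skew x y)) ⟩
      f x + iter f (π x) y - (x + y)          ≡⟨ cong (λ t → f x + t - (x + y)) (iter-H (π x) y) ⟩
      f x + (y + H (π x) y) - (x + y)         ≡⟨ lemma (f x) (H (π x) y) x y ⟩
      h x + H (π x) y                         ∎
      where
      open Mod p
      lemma : ∀ a t x y → a + (y + t) - (x + y) ≡ a - x + t
      lemma = solve-∀

    -- The character attached to a nonzero displacement

    module Nontrivial (z : ℤ) (Fz≢0 : ¬ F z ≡ 0ℤ [ p ]) where
      open Mod p

      cancel-Fz : x * F z ≡ y * F z [ p ] → x ≡ y [ p ]
      cancel-Fz {x} {y} e = mod-*-cancelˡ pp (F z) Fz≢0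
        (mod-trans (mod-reflexive (ℤₚ.*-comm (F z) x)) (mod-trans e (mod-reflexive (ℤₚ.*-comm y (F z)))))

      -- `F (f (x + z))` is computed once by `F-f` and once through the skew identity. There the
      -- unknown exponent `π x` enters only through `r^(π x) = r`.
      s-f : ∀ x → s (f x) ≡ s x [ p ]
      s-f x = mod-sym (cancel-Fz (mod-*-cancelˡ pp r r≢0 (mod-cancelˡ (r * F x) (begin
        r * F x + r * (s x * F z)                   ≡⟨ ℤₚ.*-distribˡ-+ r (F x) (s x * F z) ⟨
        r * (F x + s x * F z)                       ≈⟨ mod-*ˡ r (F-+ x z) ⟨
        r * F (x + z)                               ≈⟨ F-f (x + z) ⟨
        F (f (x + z))                               ≈⟨ F-cong (to-16 (skew x z)) ⟩
        F (f x + iter f (π x) z)                    ≈⟨ F-+ (f x) (iter f (π x) z) ⟩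
        F (f x) + s (f x) * F (iter f (π x) z)
          ≈⟨ mod-+ (F-f x) (mod-*ˡ (s (f x)) (mod-trans (F-iter (π x) z) (mod-*ʳ (F z) (multiplier-π x)))) ⟩
        r * F x + s (f x) * (r * F z)               ≡⟨ cong (λ t → r * F x + t) (lemma (s (f x)) r (F z)) ⟩
        r * F x + r * (s (f x) * F z)               ∎))))
        where
        lemma : ∀ a r b → a * (r * b) ≡ r * (a * b)
        lemma = solve-∀

      -- With `s z = 1` the map `F` would be additive on multiples of z, so that
      -- `16 F z = F (16 z) = F 0 = 0`.
      sz≢1 : ¬ s z ≡ 1ℤ [ p ]
      sz≢1 sz≡1 = sixteen≢0 (zero-factorˡ pp {F z} {+ 16} Fz≢0 (mod-trans (mod-sym (multiple 16)) (mod-trans (F-cong {x = + 16 * z} {0ℤ} (by z (lemma z))) F-zero)))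
        where
        lemma : ∀ z → + 16 * z ≡ 0ℤ + z * + 16
        lemma = solve-∀
        lemma₀ : ∀ a → 0ℤ * a ≡ 0ℤ
        lemma₀ = solve-∀
        lemma₁ : ∀ k z → (1ℤ + k) * z ≡ z + k * z
        lemma₁ = solve-∀
        lemma₂ : ∀ k a → a + 1ℤ * (k * a) ≡ (1ℤ + k) * a
        lemma₂ = solve-∀
        multiple : ∀ k → F (+ k * z) ≡ + k * F z [ p ]
        multiple zero    = mod-trans (mod-reflexive (cong F (lemma₀ z))) (mod-trans F-zero (mod-reflexive (sym (lemma₀ (F z)))))
        multiple (suc k) = begin
          F (+ suc k * z)            ≡⟨ cong F (trans (cong (λ t → t * z) (pos-+ 1 k)) (lemma₁ (+ k) z)) ⟩
          F (z + + k * z)            ≈⟨ F-+ z (+ k * z) ⟩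
          F z + s z * F (+ k * z)    ≈⟨ mod-+ˡ (F z) (mod-* sz≡1 (multiple k)) ⟩
          F z + 1ℤ * (+ k * F z)     ≡⟨ lemma₂ (+ k) (F z) ⟩
          (1ℤ + + k) * F z           ≡⟨ cong (λ t → t * F z) (pos-+ 1 k) ⟨
          + suc k * F z              ∎

      sz-1≢0 : ¬ s z - 1ℤ ≡ 0ℤ [ p ]
      sz-1≢0 e = sz≢1 (mod-cancelʳ (- 1ℤ) e)

      -- Expanding `F (z + f z)` in both orders yields `(r − 1) (s z − 1) F z = 0`.
      r≡1 : r ≡ 1ℤ [ p ]
      r≡1 = mod-cancelʳ (- 1ℤ) (zero-factorˡ pp {s z - 1ℤ} {r - 1ℤ} sz-1≢0 (cancel-Fz (begin
        (r - 1ℤ) * (s z - 1ℤ) * F z                     ≡⟨ lemma₁ r (s z) (F z) ⟩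
        F z + s z * (r * F z) - (r * F z + s z * F z)   ≈⟨ mod-+ʳ (- (r * F z + s z * F z)) comm ⟩
        r * F z + s z * F z - (r * F z + s z * F z)     ≡⟨ lemma₂ (r * F z + s z * F z) (F z) ⟩
        0ℤ * F z                                        ∎)))
        where
        lemma₁ : ∀ r s a → (r - 1ℤ) * (s - 1ℤ) * a ≡ a + s * (r * a) - (r * a + s * a)
        lemma₁ = solve-∀
        lemma₂ : ∀ a b → a - a ≡ 0ℤ * b
        lemma₂ = solve-∀
        comm : F z + s z * (r * F z) ≡ r * F z + s z * F z [ p ]
        comm = begin
          F z + s z * (r * F z)     ≈⟨ mod-+ˡ (F z) (mod-*ˡ (s z) (F-f z)) ⟨
          F z + s z * F (f z)       ≈⟨ F-+ z (f z) ⟨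
          F (z + f z)               ≡⟨ cong F (ℤₚ.+-comm z (f z)) ⟩
          F (f z + z)               ≈⟨ F-+ (f z) z ⟩
          F (f z) + s (f z) * F z   ≈⟨ mod-+ (F-f z) (mod-*ʳ (F z) (s-f z)) ⟩
          r * F z + s z * F z       ∎

      s-cong : x ≡ y [ 16 ] → s x ≡ s y [ p ]
      s-cong {x} {y} e = cancel-Fz (mod-cancelˡ (F y) (begin
        F y + s x * F z    ≈⟨ mod-+ʳ (s x * F z) (F-cong e) ⟨
        F x + s x * F z    ≈⟨ F-+ x z ⟨
        F (x + z)          ≈⟨ F-cong (mod-+ʳ z e) ⟩
        F (y + z)          ≈⟨ F-+ y z ⟩
        F y + s y * F z    ∎))

      s-zero : s 0ℤ ≡ 1ℤ [ p ]
      s-zero = cancel-Fz (begin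
        s 0ℤ * F z           ≡⟨ ℤₚ.+-identityˡ _ ⟨
        0ℤ + s 0ℤ * F z      ≈⟨ mod-+ʳ (s 0ℤ * F z) F-zero ⟨
        F 0ℤ + s 0ℤ * F z    ≈⟨ F-+ 0ℤ z ⟨
        F (0ℤ + z)           ≡⟨ cong F (ℤₚ.+-identityˡ z) ⟩
        F z                  ≡⟨ ℤₚ.*-identityˡ (F z) ⟨
        1ℤ * F z             ∎)

      -- The two bracketings of `F (x + y + z)` differ only in the coefficient of `F z`.
      s-+ : ∀ x y → s (x + y) ≡ s x * s y [ p ]
      s-+ x y = cancel-Fz (mod-cancelˡ (F (x + y)) (begin
        F (x + y) + s (x + y) * F z          ≈⟨ F-+ (x + y) z ⟨
        F (x + y + z)                        ≡⟨ cong F (ℤₚ.+-assoc x y z) ⟩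
        F (x + (y + z))                      ≈⟨ mod-trans (F-+ x (y + z)) (mod-+ˡ (F x) (mod-*ˡ (s x) (F-+ y z))) ⟩
        F x + s x * (F y + s y * F z)        ≡⟨ lemma (F x) (F y) (s x) (s y) (F z) ⟩
        F x + s x * F y + s x * s y * F z    ≈⟨ mod-+ʳ (s x * s y * F z) (F-+ x y) ⟨
        F (x + y) + s x * s y * F z          ∎))
        where
        lemma : ∀ a b s t c → a + s * (b + t * c) ≡ a + s * b + s * t * c
        lemma = solve-∀

      s-inverse : ∀ x → s x * s (- x) ≡ 1ℤ [ p ]
      s-inverse x = mod-trans (mod-sym (s-+ x (- x))) (mod-trans (mod-reflexive (cong s (ℤₚ.+-inverseʳ x))) s-zero)

      ω : ℤ → ℤ
      ω y = s (- y)

      ω-cong : x ≡ y [ 16 ] → ω x ≡ ω y [ p ]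
      ω-cong e = s-cong (mod-neg e)

      ω-shift : ∀ x y → ω (- x + y) ≡ s x * ω y [ p ]
      ω-shift x y = mod-trans (mod-reflexive (cong s (lemma x y))) (s-+ x (- y))
        where
        lemma : ∀ x y → - (- x + y) ≡ x + - y
        lemma = solve-∀

      -- `f` need not commute with negation, so this does not follow from `s-f` at `− y`. Instead
      -- `ω y` and `ω (f y)` are both inverse to `s y = s (f y)`.
      ω-f : ∀ y → ω (f y) ≡ ω y [ p ]
      ω-f y = begin
        ω (f y)                        ≡⟨ ℤₚ.*-identityˡ (ω (f y)) ⟨
        1ℤ * ω (f y)                   ≈⟨ mod-*ʳ (ω (f y)) (s-inverse y) ⟨
        s y * ω y * ω (f y)            ≈⟨ mod-*ʳ (ω (f y)) (mod-*ʳ (ω y) (s-f y)) ⟨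
        s (f y) * ω y * ω (f y)        ≡⟨ lemma (s (f y)) (ω y) (ω (f y)) ⟩
        s (f y) * ω (f y) * ω y        ≈⟨ mod-*ʳ (ω y) (s-inverse (f y)) ⟩
        1ℤ * ω y                       ≡⟨ ℤₚ.*-identityˡ (ω y) ⟩
        ω y                            ∎
        where
        lemma : ∀ a b c → a * b * c ≡ a * c * b
        lemma = solve-∀

      -- Here `r = 1` is needed: all points of a coset of P are moved by the same amount mod p, so
      -- `h` lives on ℤ/16.
      h-cong : x ≡ y [ 16 ] → h x ≡ h y [ p ]
      h-cong {x} {y} (by k refl) = begin
        f (y + k * + 16) - (y + k * + 16)      ≈⟨ mod-+ʳ (- (y + k * + 16)) (to-p (fib y k)) ⟩
        f y + r * k * + 16 - (y + k * + 16)    ≈⟨ mod-+ʳ (- (y + k * + 16)) (mod-+ˡ (f y) (mod-*ʳ (+ 16) (mod-*ʳ k r≡1))) ⟩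
        f y + 1ℤ * k * + 16 - (y + k * + 16)   ≡⟨ lemma (f y) y k (+ 16) ⟩
        h y                                    ∎
        where
        lemma : ∀ a y k s → a + 1ℤ * k * s - (y + k * s) ≡ a - y
        lemma = solve-∀

      total-shift : ∀ g c → (∀ {x y} → x ≡ y [ 16 ] → g x ≡ g y [ p ]) →
        total 16 g ≡ total 16 (λ y → g (c + y)) [ p ]
      total-shift g c g-cong = total-permute 16 g (λ y → c + y) (λ y → - c + y) g-cong (mod-+ˡ c) (mod-+ˡ (- c))
        (λ y → mod-reflexive (lemma c y)) (λ y → mod-reflexive (lemma′ c y))
        where
        lemma : ∀ c y → c + (- c + y) ≡ y
        lemma = solve-∀
        lemma′ : ∀ c y → - c + (c + y) ≡ y
        lemma′ = solve-∀

      total-f : ∀ g → (∀ {x y} → x ≡ y [ 16 ] → g x ≡ g y [ p ]) → total 16 g ≡ total 16 (g ∘ f) [ p ]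
      total-f g g-cong = total-permute 16 g f (iter f 7) g-cong (Skew.cong-mod S₁₆) (S₁₆.iter-cong 7)
        fixes₁₆ (λ y → mod-trans (mod-reflexive (iter-swap f 7 1 y)) (fixes₁₆ y))

      Ω A : ℤ
      Ω = total 16 ω
      A = total 16 (λ y → ω y * h y)

      -- `f` permutes ℤ/16 and preserves the weight, so every point of the orbit contributes the
      -- same sum.
      total-orbit : ∀ k → total 16 (λ y → ω y * h (iter f k y)) ≡ A [ p ]
      total-orbit zero    = mod-refl
      total-orbit (suc k) = begin
        total 16 (λ y → ω y * h (f (iter f k y)))
          ≈⟨ total-cong 16 (λ y → mod-* (mod-sym (ω-f y)) (mod-reflexive (cong h (iter-swap f 1 k y)))) ⟩
        total 16 (λ y → ω (f y) * h (iter f k (f y)))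
          ≈⟨ total-f (λ y → ω y * h (iter f k y)) (λ e → mod-* (ω-cong e) (h-cong (S₁₆.iter-cong k e))) ⟨
        total 16 (λ y → ω y * h (iter f k y))            ≈⟨ total-orbit k ⟩
        A                                                ∎

      total-H : ∀ k → total 16 (λ y → ω y * H k y) ≡ + k * A [ p ]
      total-H zero    = begin
        total 16 (λ y → ω y * 0ℤ)    ≈⟨ total-cong 16 (λ y → mod-reflexive (ℤₚ.*-zeroʳ (ω y))) ⟩
        total 16 (λ _ → 0ℤ)          ≡⟨ total-const 16 0ℤ ⟩
        0ℤ                           ≡⟨ ℤₚ.*-zeroˡ A ⟨
        0ℤ * A                       ∎
      total-H (suc k) = begin
        total 16 (λ y → ω y * (h (iter f k y) + H k y))
          ≈⟨ total-cong 16 (λ y → mod-reflexive (ℤₚ.*-distribˡ-+ (ω y) (h (iter f k y)) (H k y))) ⟩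
        total 16 (λ y → ω y * h (iter f k y) + ω y * H k y)  ≡⟨ total-+ 16 (λ y → ω y * h (iter f k y)) (λ y → ω y * H k y) ⟩
        total 16 (λ y → ω y * h (iter f k y)) + total 16 (λ y → ω y * H k y)         ≈⟨ mod-+ (total-orbit k) (total-H k) ⟩
        A + + k * A                                                                  ≡⟨ lemma (+ k) A ⟩
        (1ℤ + + k) * A                                                               ≡⟨ cong (λ t → t * A) (pos-+ 1 k) ⟨
        + suc k * A                                                                  ∎
        where
        lemma : ∀ k a → a + k * a ≡ (1ℤ + k) * a
        lemma = solve-∀

      -- Translation by `− z` multiplies the sum by `s z`, which is not 1: the usual vanishing of a
      -- nontrivial character sum.
      Ω≡0 : Ω ≡ 0ℤ [ p ]
      Ω≡0 = zero-factorˡ pp {s z - 1ℤ} {Ω} sz-1≢0 (begin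
        Ω * (s z - 1ℤ)                    ≡⟨ lemma (s z) Ω ⟩
        s z * Ω - Ω                       ≡⟨ cong (λ t → t - Ω) (total-* 16 (s z) ω) ⟨
        total 16 (λ y → s z * ω y) - Ω    ≈⟨ mod-+ʳ (- Ω) (total-cong 16 (ω-shift z)) ⟨
        total 16 (λ y → ω (- z + y)) - Ω  ≈⟨ mod-+ʳ (- Ω) (total-shift ω (- z) ω-cong) ⟨
        Ω - Ω                             ≡⟨ ℤₚ.+-inverseʳ Ω ⟩
        0ℤ                                ∎)
        where
        lemma : ∀ s o → o * (s - 1ℤ) ≡ s * o - o
        lemma = solve-∀

      -- Weighting `F = H T` by ω gives `G`, with sum `B = T A`. Translating by `− z` gives
      -- `B = − 16 F z + s z B`, so `A = 0` would force `16 F z = 0`.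
      A≢0 : ¬ A ≡ 0ℤ [ p ]
      A≢0 A≡0 = sixteen≢0 (zero-factorˡ pp {F z} {+ 16} Fz≢0 16Fz≡0)
        where
        G : ℤ → ℤ
        G y = - F (- y)
        B : ℤ
        B = total 16 G
        -- Comes from `0 = F (− y + y) = F (− y) + ω y F y`.
        ωF : ∀ y → ω y * H T y ≡ G y [ p ]
        ωF y = begin
          ω y * H T y  ≡⟨ cong (λ t → ω y * t) (trans (lemma (H T y) y) (cong (λ t → t - y) (sym (iter-H T y)))) ⟩
          ω y * F y                            ≡⟨ lemma′ (F (- y)) (ω y * F y) ⟩
          - F (- y) + (F (- y) + ω y * F y)    ≈⟨ mod-+ˡ (- F (- y)) (F-+ (- y) y) ⟨
          - F (- y) + F (- y + y)              ≡⟨ cong (λ t → - F (- y) + F t) (ℤₚ.+-inverseˡ y) ⟩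
          - F (- y) + F 0ℤ                     ≈⟨ mod-+ˡ (- F (- y)) F-zero ⟩
          - F (- y) + 0ℤ                       ≡⟨ ℤₚ.+-identityʳ _ ⟩
          G y                                  ∎
          where
          lemma : ∀ t y → t ≡ y + t - y
          lemma = solve-∀
          lemma′ : ∀ a b → b ≡ - a + (a + b)
          lemma′ = solve-∀
        B≡0 : B ≡ 0ℤ [ p ]
        B≡0 = begin
          B                               ≈⟨ total-cong 16 ωF ⟨
          total 16 (λ y → ω y * H T y)    ≈⟨ total-H T ⟩
          + T * A                         ≈⟨ mod-*ˡ (+ T) A≡0 ⟩
          + T * 0ℤ                        ≡⟨ ℤₚ.*-zeroʳ (+ T) ⟩
          0ℤ                              ∎
        G-shift : ∀ y → G (- z + y) ≡ - F z + s z * G y [ p ]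
        G-shift y = begin
          - F (- (- z + y))            ≡⟨ cong (λ t → - F t) (lemma z y) ⟩
          - F (z + - y)                ≈⟨ mod-neg (F-+ z (- y)) ⟩
          - (F z + s z * F (- y))      ≡⟨ lemma′ (F z) (s z) (F (- y)) ⟩
          - F z + s z * G y            ∎
          where
          lemma : ∀ x y → - (- x + y) ≡ x + - y
          lemma = solve-∀
          lemma′ : ∀ a s b → - (a + s * b) ≡ - a + s * - b
          lemma′ = solve-∀
        16Fz≡0 : + 16 * F z ≡ 0ℤ [ p ]
        16Fz≡0 = begin
          + 16 * F z                                                            ≡⟨ lemma (F z) (s z) ⟩
          - (+ 16 * - F z + s z * 0ℤ)  ≈⟨ mod-neg (mod-+ˡ (+ 16 * - F z) (mod-*ˡ (s z) B≡0)) ⟨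
          - (+ 16 * - F z + s z * B)  ≡⟨ cong₂ (λ u v → - (u + v)) (total-const 16 (- F z)) (total-* 16 (s z) G) ⟨
          - (total 16 (λ _ → - F z) + total 16 (λ y → s z * G y))  ≡⟨ cong -_ (total-+ 16 (λ _ → - F z) (λ y → s z * G y)) ⟨
          - total 16 (λ y → - F z + s z * G y)                                  ≈⟨ mod-neg (total-cong 16 G-shift) ⟨
          - total 16 (λ y → G (- z + y))  ≈⟨ mod-neg (total-shift G (- z) (λ e → mod-neg (F-cong (mod-neg e)))) ⟨
          - B                                                                   ≈⟨ mod-neg B≡0 ⟩
          0ℤ                                                                    ∎
          where
          lemma : ∀ a s → + 16 * a ≡ - (+ 16 * - a + s * 0ℤ)
          lemma = solve-∀

      -- Weight `h (x + y) = h x + H (π x) y` by `ω y` and sum over y. The right side is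
      -- `h x · Ω + π x · A` with `Ω = 0`; replacing y by `y − x` turns the left side into
      -- `s x · A`.
      π≡s : ∀ x → + π x ≡ s x [ p ]
      π≡s x = mod-*-cancelˡ pp A A≢0 (begin
        A * + π x                                                        ≡⟨ lemma (h x) A (+ π x) ⟩
        h x * 0ℤ + + π x * A                                             ≈⟨ mod-+ (mod-*ˡ (h x) Ω≡0) (total-H (π x)) ⟨
        h x * Ω + total 16 (λ y → ω y * H (π x) y)  ≡⟨ cong (λ t → t + total 16 (λ y → ω y * H (π x) y)) (total-* 16 (h x) ω) ⟨
        total 16 (λ y → h x * ω y) + total 16 (λ y → ω y * H (π x) y)    ≡⟨ total-+ 16 (λ y → h x * ω y) (λ y → ω y * H (π x) y) ⟨
        total 16 (λ y → h x * ω y + ω y * H (π x) y)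
          ≈⟨ total-cong 16 (λ y → mod-trans (mod-*ˡ (ω y) (h-+ x y)) (mod-reflexive (lemma′ (ω y) (h x) (H (π x) y)))) ⟨
        total 16 (λ y → ω y * h (x + y))  ≈⟨ total-cong 16 (λ y → mod-*ʳ (h (x + y)) (mod-reflexive (cong ω (lemma″ x y)))) ⟩
        total 16 (λ y → ω (- x + (x + y)) * h (x + y))
          ≈⟨ total-shift (λ y → ω (- x + y) * h y) x (λ e → mod-* (ω-cong (mod-+ˡ (- x) e)) (h-cong e)) ⟨
        total 16 (λ y → ω (- x + y) * h y)
          ≈⟨ total-cong 16 (λ y → mod-trans (mod-*ʳ (h y) (ω-shift x y)) (mod-reflexive (ℤₚ.*-assoc (s x) (ω y) (h y)))) ⟩
        total 16 (λ y → s x * (ω y * h y))                               ≡⟨ total-* 16 (s x) (λ y → ω y * h y) ⟩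
        s x * A                                                          ≡⟨ ℤₚ.*-comm (s x) A ⟩
        A * s x                                                          ∎)
        where
        lemma : ∀ h a q → a * q ≡ h * 0ℤ + q * a
        lemma = solve-∀
        lemma′ : ∀ w h t → w * (h + t) ≡ h * w + w * t
        lemma′ = solve-∀
        lemma″ : ∀ x y → y ≡ - x + (x + y)
        lemma″ = solve-∀

      π-f : ∀ x → + π (f x) ≡ + π x [ p ]
      π-f x = mod-trans (π≡s (f x)) (mod-trans (s-f x) (mod-sym (π≡s x)))

    -- Comparison of the exponents at φ x and at x

    module _ (coset₁₆ : ∀ x y → f (f x + y) + f x ≡ f (x + y) + f (f x) [ 16 ]) (x : ℤ) where

      private
        -- `D` stands for `a − b`: as `E = b + b M′` is a multiple of the period, `b M′` represents
        -- `− b`.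
        a b D E : ℕ
        a = π (f x)
        b = π x
        D = a ℕ.+ b ℕ.* M′
        E = b ℕ.* suc M′

        E≡ : b ℕ.+ b ℕ.* M′ ≡ E
        E≡ = sym (ℕₚ.*-suc b M′)

        E-fixes : Fixes f N E
        E-fixes = fixes-* b {suc M′} period

        exponents₁₆ : ∀ y → iter f a y ≡ iter f b y [ 16 ]
        exponents₁₆ y = mod-cancelˡ (f (f x) + f x) (begin
          f (f x) + f x + iter f a y       ≡⟨ lemma (f (f x)) (f x) (iter f a y) ⟩
          f (f x) + iter f a y + f x       ≈⟨ mod-+ʳ (f x) (Skew.skew S₁₆ (f x) y) ⟨
          f (f x + y) + f x                ≈⟨ coset₁₆ x y ⟩
          f (x + y) + f (f x)              ≈⟨ mod-+ʳ (f (f x)) (Skew.skew S₁₆ x y) ⟩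
          f x + iter f b y + f (f x)       ≡⟨ lemma′ (f (f x)) (f x) (iter f b y) ⟩
          f (f x) + f x + iter f b y       ∎)
          where
          open Mod 16
          lemma : ∀ u v t → u + v + t ≡ u + t + v
          lemma = solve-∀
          lemma′ : ∀ u v t → v + t + u ≡ u + v + t
          lemma′ = solve-∀

        D-fixes : Fixes f 16 D
        D-fixes y = begin
          iter f D y                        ≡⟨ iter-+ f a (b ℕ.* M′) y ⟩
          iter f a (iter f (b ℕ.* M′) y)    ≈⟨ exponents₁₆ (iter f (b ℕ.* M′) y) ⟩
          iter f b (iter f (b ℕ.* M′) y)    ≡⟨ iter-+ f b (b ℕ.* M′) y ⟨
          iter f (b ℕ.+ b ℕ.* M′) y         ≡⟨ cong (λ k → iter f k y) E≡ ⟩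
          iter f E y                        ≈⟨ to-16 (E-fixes y) ⟩
          y                                 ∎
          where open Mod 16

        rᴱ≡1 : r ^ E ≡ 1ℤ [ p ]
        rᴱ≡1 = power-of-multiplier E 1ℤ (E-fixes (+ 16))

        rᴰ≡1 : r ^ D ≡ 1ℤ [ p ]
        rᴰ≡1 = begin
          r ^ D                        ≡⟨ ℤₚ.^-distribˡ-+-* r a (b ℕ.* M′) ⟩
          r ^ a * r ^ (b ℕ.* M′)       ≈⟨ mod-*ʳ (r ^ (b ℕ.* M′)) (mod-trans (multiplier-π (f x)) (mod-sym (multiplier-π x))) ⟩
          r ^ b * r ^ (b ℕ.* M′)       ≡⟨ ℤₚ.^-distribˡ-+-* r b (b ℕ.* M′) ⟨
          r ^ (b ℕ.+ b ℕ.* M′)         ≡⟨ cong (r ^_) E≡ ⟩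
          r ^ E                        ≈⟨ rᴱ≡1 ⟩
          1ℤ                           ∎
          where open Mod p

        EF≡0 : ∀ y → + E * F y ≡ 0ℤ [ p ]
        EF≡0 y = mod-trans (mod-sym (displacement E (λ z → to-16 (E-fixes z)) rᴱ≡1 y))
          (mod-trans (mod-+ʳ (- y) (to-p (E-fixes y))) (mod-reflexive (ℤₚ.+-inverseʳ y)))

        F-dichotomy : (∀ y → F y ≡ 0ℤ [ p ]) ⊎ (∃ λ z → ¬ F z ≡ 0ℤ [ p ])
        F-dichotomy with Finₚ.all? {n = 16} (λ i → mod-dec p (F (+ toℕ i)) 0ℤ)
        ... | yes F≡0 = inj₁ λ y → mod-trans (F-cong (residue-≡ 16 y)) (F≡0 (residue 16 y))
        ... | no ¬F≡0 with Finₚ.¬∀⟶∃¬ 16 _ (λ i → mod-dec p (F (+ toℕ i)) 0ℤ) ¬F≡0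
        ...   | i , Fi≢0 = inj₂ (+ toℕ i , Fi≢0)

        -- Where `F` is nonzero, invariance of π mod p gives `D ≡ E`, and `E F` vanishes because
        -- `f^E` is the identity.
        DF≡0 : (∀ y → F y ≡ 0ℤ [ p ]) ⊎ (∃ λ z → ¬ F z ≡ 0ℤ [ p ]) → ∀ y → + D * F y ≡ 0ℤ [ p ]
        DF≡0 (inj₁ F≡0) y = mod-trans (mod-*ˡ (+ D) (F≡0 y)) (mod-reflexive (ℤₚ.*-zeroʳ (+ D)))
        DF≡0 (inj₂ (z , Fz≢0)) y = mod-trans (mod-*ʳ (F y) (begin
          + D                          ≡⟨ pos-+ a (b ℕ.* M′) ⟩
          + a + + (b ℕ.* M′)           ≈⟨ mod-+ʳ (+ (b ℕ.* M′)) (Nontrivial.π-f z Fz≢0 x) ⟩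
          + b + + (b ℕ.* M′)           ≡⟨ pos-+ b (b ℕ.* M′) ⟨
          + (b ℕ.+ b ℕ.* M′)           ≡⟨ cong +_ E≡ ⟩
          + E                          ∎)) (EF≡0 y)
          where open Mod p

      exponents : ∀ y → iter f (π (f x)) y ≡ iter f (π x) y [ N ]
      exponents y = begin
        iter f a y                                     ≈⟨ iter-cong a (E-fixes y) ⟨
        iter f a (iter f E y)  ≡⟨ cong (λ k → iter f a (iter f k y)) (trans (sym E≡) (ℕₚ.+-comm b (b ℕ.* M′))) ⟩
        iter f a (iter f (b ℕ.* M′ ℕ.+ b) y)           ≡⟨ cong (iter f a) (iter-+ f (b ℕ.* M′) b y) ⟩
        iter f a (iter f (b ℕ.* M′) (iter f b y))      ≡⟨ iter-+ f a (b ℕ.* M′) (iter f b y) ⟨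
        iter f D (iter f b y)                          ≈⟨ fixes-from-displacement D D-fixes rᴰ≡1 (DF≡0 F-dichotomy) (iter f b y) ⟩
        iter f b y                                     ∎
        where open Mod N

  exponents-mod-16p : ∀ {f π M′ p} → Prime p → p ℕ.% 2 ≡ 1 → Skew f π M′ (16 ℕ.* p) →
    ∀ x y → iter f (π (f x)) y ≡ iter f (π x) y [ 16 ℕ.* p ]
  exponents-mod-16p {f} {π} {M′} {p} pp p%2≡1 S x y =
    subst (λ n → iter f (π (f x)) y ≡ iter f (π x) y [ n ]) (ℕₚ.*-comm p 16)
      (Displacement.exponents {r = r} pp p≢2 S′ S₁₆ fib r≢0 (fixes₁₆ S₁₆) (l ℕ.* 8)
        (SkewProperties.fixes-* S₁₆ l {8} (fixes₁₆ S₁₆)) T≡1 rᵀ≡1 (coset-preserving₁₆ S₁₆) x y)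
    where
    instance
      _ : ℕ.NonZero p
      _ = prime⇒nonZero pp
    p≢2 : p ≢ 2
    p≢2 p≡2 = contradiction (trans (sym (cong (ℕ._% 2) p≡2)) p%2≡1) λ ()
    odd : p ≡ suc (2 ℕ.* (p ℕ./ 2))
    odd = trans (ℕ/.m≡m%n+[m/n]*n p 2) (cong₂ ℕ._+_ p%2≡1 (ℕₚ.*-comm (p ℕ./ 2) 2))
    S′ : Skew f π M′ (p ℕ.* 16)
    S′ = subst (Skew f π M′) (ℕₚ.*-comm 16 p) S
    ker : Ker f (p ℕ.* 16) (+ 16)
    ker = subst (λ n → Ker f n (+ 16)) (ℕₚ.*-comm 16 p) (odd-part-in-kernel pp (p ℕ./ 2) odd 4 S)
    quotient : Skew f π M′ 16 × ∃ (Fibre f p 16)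
    quotient = quotient-step {q = p} {16} S′ ker
    S₁₆ : Skew f π M′ 16
    S₁₆ = proj₁ quotient
    r : ℤ
    r = proj₁ (proj₂ quotient)
    fib : Fibre f p 16 r
    fib = proj₂ (proj₂ quotient)
    r≢0 : ¬ r ≡ 0ℤ [ p ]
    r≢0 = FibreProperties.multiplier≢0 {q = p} {16} {r} S′ fib (ℕ.nonTrivial⇒n>1 p {{prime⇒nonTrivial pp}})
    exponent : ∃ λ l → + (l ℕ.* 8) ≡ 1ℤ [ p ] × r ^ (l ℕ.* 8) ≡ 1ℤ [ p ]
    exponent = common-exponent pp p≢2 r r≢0
    l : ℕ
    l = proj₁ exponent
    T≡1 : + (l ℕ.* 8) ≡ 1ℤ [ p ]
    T≡1 = proj₁ (proj₂ exponent)
    rᵀ≡1 : r ^ (l ℕ.* 8) ≡ 1ℤ [ p ]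
    rᵀ≡1 = proj₂ (proj₂ exponent)

  -- Transfer from permutations of `Fin` to maps of ℤ

  open import Defs

  module Lift {n : ℕ} (φ : Permutation′ (suc n)) (φ-skew : IsSkewMorphism φ)
    (M′ : ℕ) (M-power : IsIdentityPower φ (suc M′)) where

    private
      N : ℕ
      N = suc n

    f : ℤ → ℤ
    f z = + toℕ (φ ⟨$⟩ʳ residue N z)

    π : ℤ → ℕ
    π z = proj₁ (proj₂ φ-skew (residue N z))

    residue-cong : x ≡ y [ N ] → residue N x ≡ residue N y
    residue-cong e = Finₚ.toℕ-injective (rep-cong N e)

    residue-toℕ : ∀ (i : Fin N) → residue N (+ toℕ i) ≡ i
    residue-toℕ i = Finₚ.toℕ-injective (rep-unique N mod-refl (Finₚ.toℕ<n i))

    residue-+ : ∀ x y → residue N (x + y) ≡ residue N x ⊕ residue N y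
    residue-+ x y = Finₚ.toℕ-injective (trans (sym (rep-+ N x y)) (sym (Finₚ.toℕ-fromℕ< _)))

    residue-iter : ∀ k z → residue N (iter f k z) ≡ φ ^[ k ] residue N z
    residue-iter zero    z = refl
    residue-iter (suc k) z = trans (residue-toℕ _) (cong (φ ⟨$⟩ʳ_) (residue-iter k z))

    skew-at : ∀ x k → (∀ b → φ ⟨$⟩ʳ (residue N x ⊕ b) ≡ (φ ⟨$⟩ʳ residue N x) ⊕ (φ ^[ k ] b)) →
      ∀ y → f (x + y) ≡ f x + iter f k y [ N ]
    skew-at x k eq y = rep-inj N (cong toℕ (begin
      residue N (f (x + y))                                   ≡⟨ residue-toℕ _ ⟩
      φ ⟨$⟩ʳ residue N (x + y)                                ≡⟨ cong (φ ⟨$⟩ʳ_) (residue-+ x y) ⟩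
      φ ⟨$⟩ʳ (residue N x ⊕ residue N y)                      ≡⟨ eq (residue N y) ⟩
      (φ ⟨$⟩ʳ residue N x) ⊕ (φ ^[ k ] residue N y)           ≡⟨ cong₂ _⊕_ (residue-toℕ _) (residue-iter k y) ⟨
      residue N (f x) ⊕ residue N (iter f k y)                ≡⟨ residue-+ (f x) (iter f k y) ⟨
      residue N (f x + iter f k y)                            ∎))
      where open ≡-Reasoning

    skew-morphism : Skew f π M′ N
    skew-morphism = record
      { cong-mod = λ e → mod-reflexive (cong (λ i → + toℕ (φ ⟨$⟩ʳ i)) (residue-cong e))
      ; zero-mod = mod-reflexive (cong (+_ ∘ toℕ) (trans (cong (φ ⟨$⟩ʳ_) (residue-toℕ e)) (proj₁ φ-skew)))
      ; skew     = λ x → skew-at x (π x) (proj₂ (proj₂ (proj₂ φ-skew (residue N x))))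
      ; period   = λ x → rep-inj N (cong toℕ (trans (residue-iter (suc M′) x) (M-power (residue N x))))
      }

    -- The exponent `π x` is an arbitrary witness, not reduced to the range up to the order. Only
    -- the map `f^(π x)` is determined, so exponents are compared through their iterates.
    exponent-unique : ∀ x {a} k → residue N x ≡ a →
      (∀ b → φ ⟨$⟩ʳ (a ⊕ b) ≡ (φ ⟨$⟩ʳ a) ⊕ (φ ^[ k ] b)) → ∀ y → iter f k y ≡ iter f (π x) y [ N ]
    exponent-unique x k refl eq y =
      mod-cancelˡ (f x) (mod-trans (mod-sym (skew-at x k eq y)) (Skew.skew skew-morphism x y))

    identity-power : ∀ k → Fixes f N k → IsIdentityPower φ k
    identity-power k fixes i = begin
      φ ^[ k ] i                              ≡⟨ cong (φ ^[ k ]_) (residue-toℕ i) ⟨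
      φ ^[ k ] residue N (+ toℕ i)            ≡⟨ residue-iter k (+ toℕ i) ⟨
      residue N (iter f k (+ toℕ i))          ≡⟨ residue-cong (fixes (+ toℕ i)) ⟩
      residue N (+ toℕ i)                     ≡⟨ residue-toℕ i ⟩
      i                                       ∎
      where open ≡-Reasoning

open IntegerModel
open import Defs
open import Data.Fin using (toℕ)
open import Data.Fin.Permutation using (Permutation′; _⟨$⟩ʳ_)
open import Data.Integer using (ℤ; +_)
open import Data.Nat as ℕ using (ℕ; suc; _*_; _%_)
import Data.Nat.Properties as ℕₚ
open import Data.Nat.Primality using (Prime)
open import Data.Product using (_,_)
open import Relation.Binary.PropositionalEquality using (_≡_; cong; subst; sym; trans)
open import Relation.Nullary using (¬_)

theorem7p2 : (p : ℕ) → Prime p → p % 2 ≡ 1 →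
    (n : ℕ) → suc n ≡ 16 * p →
    (φ : Permutation′ (suc n)) → IsSkewMorphism φ →
    (m : ℕ) → IsOrder φ m → IsCosetPreserving φ m
theorem7p2 p pp p%2≡1 n N≡16p φ φ-skew (suc M′) (_ , M-power , M-least)
  a i j (1≤i , i≤m , i-power) (1≤j , j≤m , j-power) =
  ℕₚ.≤-antisym (ℕₚ.≮⇒≥ (not-less i≤m 1≤j (λ y → mod-sym (same y)))) (ℕₚ.≮⇒≥ (not-less j≤m 1≤i same))
  where
  open Lift φ φ-skew M′ M-power
  S : Skew f π M′ (suc n)
  S = skew-morphism
  x : ℤ
  x = + toℕ a
  π-invariant : ∀ y → iter f (π (f x)) y ≡ iter f (π x) y [ suc n ]
  π-invariant y = subst (λ k → iter f (π (f x)) y ≡ iter f (π x) y [ k ]) (sym N≡16p)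
    (exponents-mod-16p pp p%2≡1 (subst (Skew f π M′) N≡16p S) x y)
  same : ∀ y → iter f i y ≡ iter f j y [ suc n ]
  same y = mod-trans
    (exponent-unique (f x) i (trans (residue-toℕ _) (cong (φ ⟨$⟩ʳ_) (residue-toℕ a))) i-power y)
    (mod-trans (π-invariant y) (mod-sym (exponent-unique x j (residue-toℕ a) j-power y)))
  -- Equal iterates with `i < j` make the power with exponent `j − i` trivial. This exponent is
  -- positive, and `1 ≤ i` keeps it strictly below the order.
  not-less : ∀ {i j} → j ℕ.≤ suc M′ → 1 ℕ.≤ i → (∀ y → iter f i y ≡ iter f j y [ suc n ]) → ¬ i ℕ.< j
  not-less {i} {j} j≤m 1≤i same i<j = M-least (j ℕ.∸ i) (ℕₚ.m<n⇒0<n∸m i<j)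
    (ℕₚ.<-≤-trans (ℕₚ.∸-monoʳ-< 1≤i (ℕₚ.<⇒≤ i<j)) j≤m)
    (identity-power (j ℕ.∸ i) λ y → iter-gap S i (j ℕ.∸ i) y
      (mod-trans (mod-reflexive (cong (λ k → iter f k y) (ℕₚ.m+[n∸m]≡n (ℕₚ.<⇒≤ i<j)))) (mod-sym (same y))))
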